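{- Let $q'$ be a prime power and $q=(q')^{4}$. Then the projective plane $PG(2,q)$ contains a $1$-saturating set of size $2\sqrt{q}+2\sqrt[4]{q}+2$.
   Context: A point set $S\subseteq PG(2,q)$ is $1$-saturating if every point of $PG(2,q)$ lies on a line spanned by two points of $S$ (or belongs to $S$), and $1$ is the smallest value with this property, i.e. $S$ does not already have the property that every point of the plane is a point of $S$ (in general, $\varrho$-saturating means every point lies in a subspace generated by $\varrho+1$ points of $S$, with $\varrho$ minimal). -}

module Defs where

open import Level using (0ℓ)
open import Data.Nat as ℕ using (ℕ; _^_; _≥_)
open import Data.Nat.Primality using (Prime)
open import Data.Fin using (Fin)
open import Data.Product using (Σ; ∃; ∃-syntax; _×_; _,_)
open import Data.Sum using (_⊎_)
open import Data.List using (List; length)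
open import Data.List.Membership.Propositional using (_∈_)
open import Relation.Nullary using (¬_)
open import Data.List.Relation.Unary.AllPairs using (AllPairs)
open import Relation.Binary.PropositionalEquality using (_≡_; _≢_)
open import Algebra.Structures using (IsCommutativeRing)
open import Function.Bundles using (_↔_)

IsPrimePower : ℕ → Set
IsPrimePower q = Σ ℕ λ p → Σ ℕ λ k → Prime p × k ≥ 1 × q ≡ p ^ k

record Field : Set₁ where
  field
    Carrier : Set
    _+_ _*_ : Carrier → Carrier → Carrier
    -_      : Carrier → Carrier
    0# 1#   : Carrier
    isCommutativeRing : IsCommutativeRing _≡_ _+_ _*_ -_ 0# 1#
    0≢1     : 0# ≢ 1#
    inverse : ∀ x → x ≢ 0# → ∃[ y ] (x * y ≡ 1#)

HasOrder : Field → ℕ → Set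
HasOrder F q = Field.Carrier F ↔ Fin q

module Projective (F : Field) where
  open Field F

  record Vec3 : Set where
    constructor ⟨_,_,_⟩
    field x y z : Carrier

  zero3 : Vec3
  zero3 = ⟨ 0# , 0# , 0# ⟩

  _·_ : Carrier → Vec3 → Vec3
  a · ⟨ x , y , z ⟩ = ⟨ a * x , a * y , a * z ⟩

  _⊕_ : Vec3 → Vec3 → Vec3
  ⟨ x , y , z ⟩ ⊕ ⟨ x' , y' , z' ⟩ = ⟨ x + x' , y + y' , z + z' ⟩

  -- points of PG(2,F): nonzero vectors of F^3 (taken up to nonzero scalars)
  Point : Set
  Point = Σ Vec3 λ v → v ≢ zero3

  _∼_ : Point → Point → Set
  (u , _) ∼ (v , _) = ∃[ λ′ ] (λ′ ≢ 0# × v ≡ λ′ · u)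

  _∈ₚ_ : Point → List Point → Set
  P ∈ₚ S = ∃[ A ] (A ∈ S × A ∼ P)

  OnLine : Point → Point → Point → Set
  OnLine (p , _) A@(a , _) B@(b , _) =
    ¬ (A ∼ B) × ∃[ α ] ∃[ β ] (p ≡ (α · a) ⊕ (β · b))

  Covers0 : List Point → Set
  Covers0 S = ∀ P → P ∈ₚ S

  Covers1 : List Point → Set
  Covers1 S = ∀ P → P ∈ₚ S ⊎ ∃[ A ] ∃[ B ] (A ∈ S × B ∈ S × OnLine P A B)

  -- S is 1-saturating: covering property for 1 and 1 is minimal
  OneSaturating : List Point → Set
  OneSaturating S = Covers1 S × ¬ Covers0 S

  DistinctPoints : List Point → Set
  DistinctPoints S = AllPairs (λ A B → ¬ (A ∼ B)) S

{-# OPTIONS --safe #-}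

-- Write k ⊂ K ⊂ F for the fields of orders q′, q′² and q′⁴. Since [F : K] = 2, every point P
-- lies on a line u ∈ K³. The set consists of two disjoint Baer subplanes of PG(2, K): the
-- points of k³, and their images under M = I + ωB with ω ∈ K ∖ k and B the companion matrix of
-- an irreducible cubic t³ - t - c over k. Since [K : k] = 2, the line u meets both subplanes,
-- in two distinct points, so P is on a line spanned by two points of the set.
-- The subfields are the fixed points of x ↦ x^q′ and x ↦ x^q′²; x^n - x divides x^Q - x,
-- so comparing numbers of roots with degrees shows that there are exactly n of them.
module Submission where

open import Defs
open import Level using (0ℓ)
open import Function using (_∘_; case_of_; Injective; _↔_; Inverse)
open import Function.Construct.Composition using (_↔-∘_)
open import Function.Construct.Identity using (↔-id)
open import Data.Empty using (⊥; ⊥-elim)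
open import Data.Unit using (⊤; tt)
open import Data.Maybe using (just; nothing)
open import Data.Product using (∃; ∃₂; ∃-syntax; _×_; _,_; proj₁; proj₂; map)
open import Data.Sum using (_⊎_; inj₁; inj₂)
open import Data.Sum.Function.Propositional using (_⊎-cong_)
open import Data.Nat as ℕ using (ℕ; zero; suc)
import Data.Nat.Properties as ℕₚ
import Data.Nat.Combinatorics as Comb
open import Data.Nat.Combinatorics using (_C_; nCn≡1)
open import Data.Nat.Divisibility using (_∣_; divides; ∣⇒≤; m∣m*n)
open import Data.Nat.Primality using (Prime; euclidsLemma; ¬prime[0]; prime⇒nonTrivial)
open import Data.Nat.Solver using (module +-*-Solver)
import Data.Integer as ℤ
import Data.Integer.Properties as ℤₚ
open import Data.Integer using (0ℤ)
open import Data.Fin as Fin using (Fin; zero; suc)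
import Data.Fin.Properties as Finₚ
open import Data.Fin.Permutation using (Permutation; permutation; _⟨$⟩ʳ_)
open import Data.Vec using (Vec; []; _∷_; _++_; replicate)
open import Data.Vec.Functional using (Vector; removeAt)
open import Data.List using (List; length; tabulate)
open import Data.List.Properties using (length-tabulate)
open import Data.List.Membership.Propositional using (_∈_)
open import Data.List.Membership.Propositional.Properties using (∈-tabulate⁺; ∈-tabulate⁻)
import Data.List.Relation.Unary.AllPairs.Properties as AllPairs
open import Relation.Nullary using (¬_; Dec; yes; no; contradiction)
open import Relation.Unary using (Pred; Decidable; ∁; _⊆_)
open import Relation.Binary.Definitions using (WeaklyDecidable)
open import Relation.Binary.PropositionalEquality hiding (setoid)
open import Algebra.Bundles using (CommutativeRing)
open import Algebra.Solver.Ring.AlmostCommutativeRing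
  using (fromCommutativeRing; _-Raw-AlmostCommutative⟶_)

-- Two demands on `M` lead to one condition on the cubic. `M` must be invertible, and `M v = 0` with
-- v nonzero would make -1/ω, an element of K, an eigenvalue of B. The second plane must avoid the
-- first, and a common point would give an eigenvector of B in k³. Both are excluded once t³ - t - c
-- has no root in K. The obstacle is that c must lie in k, so that B preserves k³, while roots must
-- be ruled out in the larger field K. The map t ↦ t³ - t takes 0 and 1 to the same value in every
-- characteristic, so on the finite set k it is not onto, and any missed value serves as c. A root
-- in K outside k would come with its conjugate and leave the third root in k, so K contains no root
-- either. Extension degrees enter as inequalities: |F| < |K|³ and |K| < |k|³ force the required
-- linear dependences by counting. Each subplane has s² + s + 1 points, s = q′ being the fourth root
-- of q, which gives the size. All points have coordinates in K, so the set is not the whole plane.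

-- Binomial coefficients modulo a prime.

binomial-absorption : ∀ n k → suc k ℕ.* (suc n C suc k) ≡ suc n ℕ.* (n C k)
binomial-absorption n zero = trans (ℕₚ.*-identityˡ _) (trans (Comb.nC1≡n (suc n)) (sym (ℕₚ.*-identityʳ (suc n))))
binomial-absorption zero (suc k) = trans (cong (suc (suc k) ℕ.*_) (Comb.k>n⇒nCk≡0 {1} {suc (suc k)} (ℕ.s≤s (ℕ.s≤s ℕ.z≤n))))
  (trans (ℕₚ.*-zeroʳ (suc (suc k))) (sym (trans (ℕₚ.*-identityˡ _) (Comb.k>n⇒nCk≡0 {0} {suc k} (ℕ.s≤s ℕ.z≤n)))))
binomial-absorption (suc n) (suc k) = begin
  suc (suc k) ℕ.* (suc (suc n) C suc (suc k))
    ≡⟨ cong (suc (suc k) ℕ.*_) (sym (Comb.nCk+nC[k+1]≡[n+1]C[k+1] (suc n) (suc k))) ⟩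
  suc (suc k) ℕ.* (a ℕ.+ (suc n C suc (suc k)))
    ≡⟨ ℕₚ.*-distribˡ-+ (suc (suc k)) a _ ⟩
  suc (suc k) ℕ.* a ℕ.+ suc (suc k) ℕ.* (suc n C suc (suc k))
    ≡⟨ cong₂ (λ u v → (a ℕ.+ u) ℕ.+ v) (binomial-absorption n k) (binomial-absorption n (suc k)) ⟩
  (a ℕ.+ suc n ℕ.* (n C k)) ℕ.+ suc n ℕ.* (n C suc k)
    ≡⟨ ℕₚ.+-assoc a _ _ ⟩
  a ℕ.+ (suc n ℕ.* (n C k) ℕ.+ suc n ℕ.* (n C suc k))
    ≡⟨ cong (a ℕ.+_) (sym (ℕₚ.*-distribˡ-+ (suc n) (n C k) _)) ⟩
  a ℕ.+ suc n ℕ.* (n C k ℕ.+ n C suc k)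
    ≡⟨ cong (λ u → a ℕ.+ suc n ℕ.* u) (Comb.nCk+nC[k+1]≡[n+1]C[k+1] n k) ⟩
  suc (suc n) ℕ.* a ∎
  where
  open ≡-Reasoning
  a = suc n C suc k

-- Absorption makes the prime `suc p` divide the product of `suc k` and the coefficient, and `suc k`
-- is too small to be a multiple of it.
prime∣binomial : ∀ {p} → Prime (suc p) → ∀ {k} → k ℕ.< p → suc p ∣ suc p C suc k
prime∣binomial {p} p-prime {k} k<p
  with euclidsLemma (suc k) (suc p C suc k) p-prime
         (subst (suc p ∣_) (sym (binomial-absorption p k)) (m∣m*n (p C k)))
... | inj₁ p∣k = ⊥-elim (ℕₚ.<⇒≱ (ℕ.s≤s k<p) (∣⇒≤ p∣k))
... | inj₂ p∣C = p∣C

-- A ring solver with integer coefficients.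

-- Terms cancel only if equality of coefficients can be decided. Integers allow this, and `φ` is the
-- canonical homomorphism from ℤ to the ring.
module ℤ-Solver (R : CommutativeRing 0ℓ 0ℓ) where
  open import Data.Integer using (ℤ; +_; -[1+_])
  open CommutativeRing R hiding (zero) renaming (refl to ≈-refl; sym to ≈-sym; trans to ≈-trans)
  open import Algebra.Properties.Semiring.Mult semiring renaming (_×_ to infixr 8 _⨉_) using (×-homo-+; ×1-homo-*)
  open import Algebra.Properties.Ring ring
  open import Relation.Binary.Reasoning.Setoid setoid

  private
    φ : ℤ → Carrier
    φ (+ n) = n ⨉ 1#
    φ -[1+ n ] = - (suc n ⨉ 1#)

    φ-⊖ : ∀ m n → φ (m ℤ.⊖ n) ≈ m ⨉ 1# - n ⨉ 1#
    φ-⊖ m zero = ≈-sym (≈-trans (+-congˡ -0#≈0#) (+-identityʳ _))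
    φ-⊖ zero (suc n) = ≈-sym (+-identityˡ _)
    φ-⊖ (suc m) (suc n) = begin
      φ (suc m ℤ.⊖ suc n) ≡⟨ cong φ (ℤₚ.[1+m]⊖[1+n]≡m⊖n m n) ⟩
      φ (m ℤ.⊖ n) ≈⟨ φ-⊖ m n ⟩
      m ⨉ 1# - n ⨉ 1# ≈⟨ +-congʳ (≈-sym (+-identityˡ _)) ⟩
      0# + m ⨉ 1# - n ⨉ 1# ≈⟨ +-congʳ (+-congʳ (≈-sym (-‿inverseʳ 1#))) ⟩
      1# - 1# + m ⨉ 1# - n ⨉ 1# ≈⟨ +-congʳ (≈-trans (+-assoc _ _ _) (≈-trans (+-congˡ (+-comm _ _)) (≈-sym (+-assoc _ _ _)))) ⟩
      1# + m ⨉ 1# - 1# - n ⨉ 1# ≈⟨ +-assoc _ _ _ ⟩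
      1# + m ⨉ 1# + (- 1# - n ⨉ 1#) ≈⟨ +-congˡ (-‿+-comm _ _) ⟩
      1# + m ⨉ 1# - (1# + n ⨉ 1#) ∎

    φ-+ : ∀ i j → φ (i ℤ.+ j) ≈ φ i + φ j
    φ-+ (+ m) (+ n) = ×-homo-+ 1# m n
    φ-+ (+ m) -[1+ n ] = φ-⊖ m (suc n)
    φ-+ -[1+ m ] (+ n) = ≈-trans (φ-⊖ n (suc m)) (+-comm _ _)
    φ-+ -[1+ m ] -[1+ n ] = begin
      - (suc (suc (m ℕ.+ n)) ⨉ 1#) ≡⟨ cong (λ k → - (suc k ⨉ 1#)) (sym (ℕₚ.+-suc m n)) ⟩
      - ((suc m ℕ.+ suc n) ⨉ 1#) ≈⟨ -‿cong (×-homo-+ 1# (suc m) (suc n)) ⟩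
      - (suc m ⨉ 1# + suc n ⨉ 1#) ≈⟨ ≈-sym (-‿+-comm _ _) ⟩
      - (suc m ⨉ 1#) - suc n ⨉ 1# ∎

    φ-neg : ∀ i → φ (ℤ.- i) ≈ - φ i
    φ-neg (+ zero) = ≈-sym -0#≈0#
    φ-neg (+ suc n) = ≈-refl
    φ-neg -[1+ n ] = ≈-sym (-‿involutive _)

    φ-*-pos : ∀ m n → φ (+ m ℤ.* + n) ≈ m ⨉ 1# * n ⨉ 1#
    φ-*-pos m n = ≈-trans (reflexive (cong φ (sym (ℤₚ.pos-* m n)))) (×1-homo-* m n)

    φ-* : ∀ i j → φ (i ℤ.* j) ≈ φ i * φ j
    φ-* (+ m) (+ n) = φ-*-pos m n
    φ-* (+ m) -[1+ n ] = begin
      φ (+ m ℤ.* -[1+ n ]) ≡⟨ cong φ (sym (ℤₚ.neg-distribʳ-* (+ m) (+ suc n))) ⟩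
      φ (ℤ.- (+ m ℤ.* + suc n)) ≈⟨ φ-neg (+ m ℤ.* + suc n) ⟩
      - φ (+ m ℤ.* + suc n) ≈⟨ -‿cong (φ-*-pos m (suc n)) ⟩
      - (m ⨉ 1# * suc n ⨉ 1#) ≈⟨ -‿distribʳ-* _ _ ⟩
      m ⨉ 1# * - (suc n ⨉ 1#) ∎
    φ-* -[1+ m ] (+ n) = begin
      φ (-[1+ m ] ℤ.* + n) ≡⟨ cong φ (sym (ℤₚ.neg-distribˡ-* (+ suc m) (+ n))) ⟩
      φ (ℤ.- (+ suc m ℤ.* + n)) ≈⟨ φ-neg (+ suc m ℤ.* + n) ⟩
      - φ (+ suc m ℤ.* + n) ≈⟨ -‿cong (φ-*-pos (suc m) n) ⟩
      - (suc m ⨉ 1# * n ⨉ 1#) ≈⟨ -‿distribˡ-* _ _ ⟩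
      - (suc m ⨉ 1#) * n ⨉ 1# ∎
    φ-* -[1+ m ] -[1+ n ] = begin
      (suc m ℕ.* suc n) ⨉ 1# ≈⟨ ×1-homo-* (suc m) (suc n) ⟩
      suc m ⨉ 1# * suc n ⨉ 1# ≈⟨ ≈-sym (-‿involutive _) ⟩
      - - (suc m ⨉ 1# * suc n ⨉ 1#) ≈⟨ -‿cong (-‿distribʳ-* _ _) ⟩
      - (suc m ⨉ 1# * - (suc n ⨉ 1#)) ≈⟨ -‿distribˡ-* _ _ ⟩
      - (suc m ⨉ 1#) * - (suc n ⨉ 1#) ∎

    morphism : ℤ.+-*-rawRing -Raw-AlmostCommutative⟶ fromCommutativeRing R
    morphism = record
      { ⟦_⟧ = φ ; +-homo = φ-+ ; *-homo = φ-* ; -‿homo = φ-neg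
      ; 0-homo = ≈-refl ; 1-homo = +-identityʳ 1# }

    φ-weaklyDec : WeaklyDecidable (λ i j → φ i ≈ φ j)
    φ-weaklyDec i j with i ℤ.≟ j
    ... | yes i≡j = just (reflexive (cong φ i≡j))
    ... | no _ = nothing

  open import Algebra.Solver.Ring ℤ.+-*-rawRing (fromCommutativeRing R) morphism φ-weaklyDec public

open ≡-Reasoning

-- Counting in finite sets.

-- Only elements are compared, never proofs of membership, so `P` may have many proofs at one
-- element and `n` still counts its elements.
record Enumeration {A : Set} (P : Pred A 0ℓ) (n : ℕ) : Set where
  field
    elem       : Fin n → A
    elem∈      : ∀ i → P (elem i)
    injective  : Injective _≡_ _≡_ elem
    surjective : ∀ {x} → P x → ∃ λ i → elem i ≡ x

  index : ∀ {x} → P x → Fin n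
  index = proj₁ ∘ surjective

  elem-index : ∀ {x} (p : P x) → elem (index p) ≡ x
  elem-index = proj₂ ∘ surjective

  index-injective : ∀ {x y} (p : P x) (q : P y) → index p ≡ index q → x ≡ y
  index-injective p q eq = trans (sym (elem-index p)) (trans (cong elem eq) (elem-index q))

module _ where
  open Enumeration

  private
    module _ {N : ℕ} {P : Pred (Fin (suc N)) 0ℓ} where
      extend : ∀ {n} → P zero → Enumeration (P ∘ suc) n → Enumeration P (suc n)
      extend p E .elem zero = zero
      extend p E .elem (suc i) = suc (elem E i)
      extend p E .elem∈ zero = p
      extend p E .elem∈ (suc i) = elem∈ E i
      extend p E .injective {zero} {zero} _ = refl
      extend p E .injective {suc i} {suc j} eq = cong suc (injective E (Finₚ.suc-injective eq))
      extend p E .surjective {zero} _ = zero , refl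
      extend p E .surjective {suc x} q = suc (index E q) , cong suc (elem-index E q)

      shift : ∀ {n} → ¬ P zero → Enumeration (P ∘ suc) n → Enumeration P n
      shift ¬p E .elem = suc ∘ elem E
      shift ¬p E .elem∈ = elem∈ E
      shift ¬p E .injective = injective E ∘ Finₚ.suc-injective
      shift ¬p E .surjective {zero} q = contradiction q ¬p
      shift ¬p E .surjective {suc x} q = index E q , cong suc (elem-index E q)

    -- The complement is counted along with the set, so that an upper bound on one becomes a lower
    -- bound on the other.
    enumerate-Fin : ∀ {N} {P : Pred (Fin N) 0ℓ} → Decidable P →
      ∃₂ λ m n → Enumeration P m × Enumeration (∁ P) n × m ℕ.+ n ≡ N
    enumerate-Fin {zero} P? = 0 , 0 , empty , empty , refl
      where
      empty : ∀ {R : Pred (Fin 0) 0ℓ} → Enumeration R 0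
      empty = record { elem = λ () ; elem∈ = λ () ; injective = λ { {()} } ; surjective = λ { {()} } }
    enumerate-Fin {suc N} P? with enumerate-Fin (P? ∘ suc) | P? zero
    ... | m , n , E , E′ , eq | yes p = suc m , n , extend p E , shift (λ ¬p → ¬p p) E′ , cong suc eq
    ... | m , n , E , E′ , eq | no ¬p = m , suc n , shift ¬p E , extend ¬p E′ , trans (ℕₚ.+-suc m n) (cong suc eq)

  module _ {A : Set} {N : ℕ} (A↔Fin : A ↔ Fin N) where
    open Inverse A↔Fin using (to; from; strictlyInverseˡ; strictlyInverseʳ)

    private
      transfer : ∀ {P : Pred A 0ℓ} {n} → Enumeration (P ∘ from) n → Enumeration P n
      transfer E .elem = from ∘ elem E
      transfer E .elem∈ = elem∈ E
      transfer E .injective {i} {j} eq = injective E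
        (trans (sym (strictlyInverseˡ _)) (trans (cong to eq) (strictlyInverseˡ _)))
      transfer {P} E .surjective {x} p =
        let p′ = subst P (sym (strictlyInverseʳ x)) p
        in index E p′ , trans (cong from (elem-index E p′)) (strictlyInverseʳ x)

    enumerate : ∀ {P : Pred A 0ℓ} → Decidable P →
      ∃₂ λ m n → Enumeration P m × Enumeration (∁ P) n × m ℕ.+ n ≡ N
    enumerate P? = let m , n , E , E′ , eq = enumerate-Fin (P? ∘ from)
                   in m , n , transfer E , transfer E′ , eq

  -- If `P` were contained in `R`, indices would inject `Fin m` into the smaller `Fin n`. This
  -- yields elements of a field outside a subfield.
  ∃-outside : ∀ {A : Set} {P R : Pred A 0ℓ} {m n} → Enumeration P m → Enumeration R n → Decidable R →
    n ℕ.< m → ∃ λ x → P x × ¬ R x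
  ∃-outside {R = R} {m} E E′ R? n<m
    with i , ¬Ri ← Finₚ.¬∀⟶∃¬ m (R ∘ elem E) (R? ∘ elem E)
      (λ all → Finₚ.<⇒notInjective n<m (λ {i} {j} eq → injective E (index-injective E′ (all i) (all j) eq)))
    = elem E i , elem∈ E i , ¬Ri

  -- If every value had a preimage, the preimages of distinct points would be distinct;
  -- but they could avoid one of two points with the same value.
  ∃-missed : ∀ {A : Set} {P : Pred A 0ℓ} {n} → Enumeration P n → ((x y : A) → Dec (x ≡ y)) →
    (f : A → A) → (∀ {x} → P x → P (f x)) →
    ∀ {a b} → P a → P b → a ≢ b → f a ≡ f b → ∃ λ c → P c × (∀ x → P x → f x ≢ c)
  ∃-missed {A} {P} {suc n} E _≟_ f f∈ {a} {b} a∈ b∈ a≢b fa≡fb =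
    let i , ¬hit = Finₚ.¬∀⟶∃¬ (suc n) Hit (λ i → Finₚ.any? λ j → f (elem E j) ≟ elem E i) not-onto
    in elem E i , elem∈ E i , λ x x∈ fx≡ → ¬hit (index E x∈ , trans (cong f (elem-index E x∈)) fx≡)
    where
    Hit : Pred (Fin (suc n)) 0ℓ
    Hit i = ∃ λ j → f (elem E j) ≡ elem E i

    not-onto : ¬ (∀ i → Hit i)
    not-onto hit = contradict (pre (index E (f∈ a∈)) Finₚ.≟ index E a∈)
      where
      pre : Fin (suc n) → Fin (suc n)
      pre = proj₁ ∘ hit

      pre-injective : Injective _≡_ _≡_ pre
      pre-injective {i} {j} eq = injective E
        (trans (sym (proj₂ (hit i))) (trans (cong (f ∘ elem E) eq) (proj₂ (hit j))))

      avoids : ∀ {z} (z∈ : P z) → f z ≡ f a → pre (index E (f∈ a∈)) ≢ index E z∈ → ∀ i → index E z∈ ≢ pre i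
      avoids {z} z∈ fz≡fa ≢z i z≡pre = ≢z (trans (cong pre (injective E (trans (elem-index E (f∈ a∈))
        (trans (sym fz≡fa) (trans (cong f (trans (sym (elem-index E z∈)) (cong (elem E) z≡pre))) (proj₂ (hit i))))))) (sym z≡pre))

      -- A value avoided by `pre` can be punched out, which would inject `Fin (suc n)` into `Fin n`.
      absurd : ∀ {k} → (∀ i → k ≢ pre i) → ⊥
      absurd k≢ = ℕₚ.1+n≰n (Finₚ.injective⇒≤ {f = λ i → Fin.punchOut (k≢ i)}
        (λ eq → pre-injective (Finₚ.punchOut-injective (k≢ _) (k≢ _) eq)))

      -- `pre` selects a single preimage of `f a`; whichever of `a` and `b` is not selected is
      -- avoided by `pre` altogether.
      contradict : Dec (pre (index E (f∈ a∈)) ≡ index E a∈) → ⊥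
      contradict (no ≢a) = absurd (avoids a∈ refl ≢a)
      contradict (yes ≡a) = absurd (avoids b∈ (sym fa≡fb)
        (λ ≡b → a≢b (index-injective E a∈ b∈ (trans (sym ≡a) ≡b))))
  ∃-missed {n = zero} E _ f f∈ a∈ _ _ _ with () ← index E a∈

-- Arithmetic in a field.

module FieldTheory (F : Field) where
  commutativeRing : CommutativeRing 0ℓ 0ℓ
  commutativeRing = record { isCommutativeRing = Field.isCommutativeRing F }

  open CommutativeRing commutativeRing
    using (Carrier; _+_; _*_; -_; _-_; 0#; 1#; semiring; commutativeSemiring; +-commutativeMonoid; *-commutativeMonoid
          ; +-comm; *-comm; *-assoc; +-identityˡ; +-identityʳ; *-identityˡ; *-identityʳ; zeroˡ; zeroʳ; -‿inverseʳ) public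
  open ℤ-Solver commutativeRing using (solve; _:=_; _:+_; _:*_; :-_; _:-_; con; Polynomial) public
  open import Algebra.Properties.Semiring.Exp semiring using (_^_; ^-homo-*; ^-assocʳ) public
  open import Algebra.Properties.CommutativeSemiring.Exp commutativeSemiring using (^-distrib-*) public
  open import Algebra.Properties.Semiring.Mult semiring renaming (_×_ to infixr 8 _⨉_) using (×-assoc-*; ×1-homo-*)
  open import Algebra.Properties.CommutativeSemiring.Binomial commutativeSemiring
    using (binomialTerm) renaming (theorem to binomialTheorem)
  open Field F using (0≢1; inverse) public

  :0 : ∀ {n} → Polynomial n
  :0 = con 0ℤ

  1≢0 : 1# ≢ 0#
  1≢0 = 0≢1 ∘ sym

  *-cancelˡ : ∀ {x y z} → x ≢ 0# → x * y ≡ x * z → y ≡ z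
  *-cancelˡ {x} {y} {z} x≢0 eq with w , xw≡1 ← inverse x x≢0 = begin
    y ≡⟨ sym (*-identityˡ y) ⟩
    1# * y ≡⟨ cong (_* y) (sym xw≡1) ⟩
    x * w * y ≡⟨ solve 3 (λ x w y → x :* w :* y := w :* (x :* y)) refl x w y ⟩
    w * (x * y) ≡⟨ cong (w *_) eq ⟩
    w * (x * z) ≡⟨ solve 3 (λ x w y → w :* (x :* y) := x :* w :* y) refl x w z ⟩
    x * w * z ≡⟨ cong (_* z) xw≡1 ⟩
    1# * z ≡⟨ *-identityˡ z ⟩
    z ∎

  x*y≡0⇒y≡0 : ∀ {x y} → x ≢ 0# → x * y ≡ 0# → y ≡ 0#
  x*y≡0⇒y≡0 {x} x≢0 xy≡0 = *-cancelˡ x≢0 (trans xy≡0 (sym (zeroʳ x)))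

  x*y≢0 : ∀ {x y} → x ≢ 0# → y ≢ 0# → x * y ≢ 0#
  x*y≢0 x≢0 y≢0 = y≢0 ∘ x*y≡0⇒y≡0 x≢0

  ^-≢0 : ∀ {x} n → x ≢ 0# → x ^ n ≢ 0#
  ^-≢0 zero x≢0 = 1≢0
  ^-≢0 (suc n) x≢0 = x*y≢0 x≢0 (^-≢0 n x≢0)

  x-y≡0⇒x≡y : ∀ {x y} → x - y ≡ 0# → x ≡ y
  x-y≡0⇒x≡y {x} {y} eq = begin
    x ≡⟨ solve 2 (λ x y → x := (x :- y) :+ y) refl x y ⟩
    (x - y) + y ≡⟨ cong (_+ y) eq ⟩
    0# + y ≡⟨ +-identityˡ y ⟩
    y ∎

  x≡y⇒x-y≡0 : ∀ {x y} → x ≡ y → x - y ≡ 0#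
  x≡y⇒x-y≡0 {x} refl = -‿inverseʳ x

  1^n≡1 : ∀ n → 1# ^ n ≡ 1#
  1^n≡1 zero = refl
  1^n≡1 (suc n) = trans (*-identityˡ _) (1^n≡1 n)

  -- Polynomials and the number of their roots.

  -- The vector lists the coefficients below the leading one, from degree 0 upwards.
  evalMonic : ∀ {n} → Vec Carrier n → Carrier → Carrier
  evalMonic [] x = 1#
  evalMonic (c ∷ cs) x = c + x * evalMonic cs x

  -- Synthetic division by x - r: the coefficients of the quotient are the intermediate values of
  -- Horner's scheme at r.
  quotient : ∀ {n} → Carrier → Vec Carrier (suc n) → Vec Carrier n
  quotient r (c ∷ []) = []
  quotient r (c ∷ cs@(_ ∷ _)) = evalMonic cs r ∷ quotient r cs

  quotient-correct : ∀ {n} r (cs : Vec Carrier (suc n)) x →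
    evalMonic cs x - evalMonic cs r ≡ (x - r) * evalMonic (quotient r cs) x
  quotient-correct r (c ∷ []) x =
    -- `1#` is passed as a variable `o`, because the solver's constant 1 denotes `1# + 0#`.
    solve 4 (λ o c x r → (c :+ x :* o) :- (c :+ r :* o) := (x :- r) :* o) refl 1# c x r
  quotient-correct r (c ∷ cs@(_ ∷ _)) x = begin
    (c + x * p) - (c + r * q)
      ≡⟨ solve 5 (λ c x p r q → (c :+ x :* p) :- (c :+ r :* q) := (x :- r) :* q :+ x :* (p :- q)) refl c x p r q ⟩
    (x - r) * q + x * (p - q)
      ≡⟨ cong (λ t → (x - r) * q + x * t) (quotient-correct r cs x) ⟩
    (x - r) * q + x * ((x - r) * s)
      ≡⟨ solve 4 (λ x r q s → (x :- r) :* q :+ x :* ((x :- r) :* s) := (x :- r) :* (q :+ x :* s)) refl x r q s ⟩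
    (x - r) * (q + x * s) ∎
    where
    p = evalMonic cs x
    q = evalMonic cs r
    s = evalMonic (quotient r cs) x

  -- Dividing by x - r for the first root r lowers the degree by one, and every other root remains a
  -- root of the quotient since x - r is nonzero there.
  rootCount≤degree : ∀ {m n} (cs : Vec Carrier n) (root : Fin m → Carrier) → Injective _≡_ _≡_ root →
    (∀ i → evalMonic cs (root i) ≡ 0#) → m ℕ.≤ n
  rootCount≤degree {zero} cs root inj vanish = ℕ.z≤n
  rootCount≤degree {suc m} [] root inj vanish = contradiction (vanish zero) 1≢0
  rootCount≤degree {suc m} cs@(_ ∷ _) root inj vanish = ℕ.s≤s
    (rootCount≤degree (quotient r cs) (root ∘ suc) (Finₚ.suc-injective ∘ inj) λ i →
      x*y≡0⇒y≡0 (λ eq → case (inj (x-y≡0⇒x≡y eq)) of λ ())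
        (trans (sym (quotient-correct r cs (root (suc i))))
               (x≡y⇒x-y≡0 (trans (vanish (suc i)) (sym (vanish zero))))))
    where
    r = root zero

  evalMonic-shift : ∀ e {n} (cs : Vec Carrier n) x → evalMonic (replicate e 0# ++ cs) x ≡ x ^ e * evalMonic cs x
  evalMonic-shift zero cs x = sym (*-identityˡ _)
  evalMonic-shift (suc e) cs x = begin
    0# + x * evalMonic (replicate e 0# ++ cs) x ≡⟨ +-identityˡ _ ⟩
    x * evalMonic (replicate e 0# ++ cs) x ≡⟨ cong (x *_) (evalMonic-shift e cs x) ⟩
    x * (x ^ e * evalMonic cs x) ≡⟨ sym (*-assoc x (x ^ e) _) ⟩
    x * x ^ e * evalMonic cs x ∎

  -- With y = x^(e+1) this is 1 + y + ... + y^j, spelled out in powers of x; the leading y^j is the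
  -- implicit monic term.
  geometric : ∀ e j → Vec Carrier (j ℕ.* suc e)
  geometric e zero = []
  geometric e (suc j) = 1# ∷ (replicate e 0# ++ geometric e j)

  geometric-sum : ∀ e j x →
    (x ^ suc e - 1#) * evalMonic (geometric e j) x ≡ x ^ (suc j ℕ.* suc e) - 1#
  geometric-sum e zero x = trans (*-identityʳ _) (cong (λ k → x ^ k - 1#) (sym (ℕₚ.+-identityʳ (suc e))))
  geometric-sum e (suc j) x = begin
    (X - 1#) * (1# + x * evalMonic (replicate e 0# ++ geometric e j) x)
      ≡⟨ cong (λ t → (X - 1#) * (1# + x * t)) (evalMonic-shift e (geometric e j) x) ⟩
    (X - 1#) * (1# + x * (x ^ e * G))
      ≡⟨ solve 4 (λ o x y g → (x :* y :- o) :* (o :+ x :* (y :* g)) := (x :* y :- o) :* o :+ x :* y :* ((x :* y :- o) :* g)) refl 1# x (x ^ e) G ⟩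
    (X - 1#) * 1# + X * ((X - 1#) * G)
      ≡⟨ cong₂ (λ s t → s + X * t) (*-identityʳ _) (geometric-sum e j x) ⟩
    (X - 1#) + X * (Y - 1#)
      ≡⟨ solve 3 (λ o x y → (x :- o) :+ x :* (y :- o) := x :* y :+ (x :- x :* o) :- o) refl 1# X Y ⟩
    X * Y + (X - X * 1#) - 1#
      ≡⟨ cong (λ t → X * Y + t - 1#) (x≡y⇒x-y≡0 (sym (*-identityʳ X))) ⟩
    X * Y + 0# - 1#
      ≡⟨ cong (_- 1#) (trans (+-identityʳ _) (sym (^-homo-* x (suc e) (suc j ℕ.* suc e)))) ⟩
    x ^ (suc (suc j) ℕ.* suc e) - 1# ∎
    where
    X = x ^ suc e
    Y = x ^ (suc j ℕ.* suc e)
    G = evalMonic (geometric e j) x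

  private
    module Sum where
      open import Algebra.Properties.CommutativeMonoid.Sum +-commutativeMonoid public
    -- The same theory read multiplicatively: `Product.sum` is a product, and `sum-replicate`
    -- produces a power.
    module Product where
      open import Algebra.Properties.CommutativeMonoid.Sum *-commutativeMonoid public

  Π-≢0 : ∀ {n} (f : Vector Carrier n) → (∀ i → f i ≢ 0#) → Product.sum f ≢ 0#
  Π-≢0 {zero} f f≢0 = 1≢0
  Π-≢0 {suc n} f f≢0 = x*y≢0 (f≢0 zero) (Π-≢0 (f ∘ suc) (f≢0 ∘ suc))

  -- The product is x^(n-1); the extra factor x avoids the subtraction in the exponent.
  x*Π-constant-off : ∀ {n} x i (f : Vector Carrier n) → f i ≡ 1# → (∀ j → j ≢ i → f j ≡ x) → x * Product.sum f ≡ x ^ n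
  x*Π-constant-off {suc n} x i f fi≡1 f≡x = cong (x *_) (begin
    Product.sum f ≡⟨ Product.sum-remove {i = i} f ⟩
    f i * Product.sum (removeAt f i) ≡⟨ cong₂ _*_ fi≡1 (Product.sum-cong-≗ (λ j → f≡x _ (Finₚ.punchInᵢ≢i i j))) ⟩
    1# * Product.sum {n} (λ _ → x) ≡⟨ *-identityˡ _ ⟩
    Product.sum {n} (λ _ → x) ≡⟨ Product.sum-replicate n ⟩
    x ^ n ∎)

  -- Finite fields.

  module Finite {Q : ℕ} (F↔Fin : HasOrder F Q) where
    open Inverse F↔Fin using (to; from; strictlyInverseˡ; strictlyInverseʳ)

    to-injective : ∀ {x y} → to x ≡ to y → x ≡ y
    to-injective eq = trans (sym (strictlyInverseʳ _)) (trans (cong from eq) (strictlyInverseʳ _))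

    infix 4 _≟_
    _≟_ : (x y : Carrier) → Dec (x ≡ y)
    x ≟ y with to x Finₚ.≟ to y
    ... | yes eq = yes (to-injective eq)
    ... | no ≢ = no (≢ ∘ cong to)

    lift : (f g : Carrier → Carrier) → (∀ x → f (g x) ≡ x) → (∀ x → g (f x) ≡ x) → Permutation Q Q
    lift f g fg gf = permutation (to ∘ f ∘ from) (to ∘ g ∘ from) (inv f g fg) (inv g f gf)
      where
      inv : ∀ f g → (∀ x → f (g x) ≡ x) → ∀ i → to (f (from (to (g (from i))))) ≡ i
      inv f g fg i = trans (cong (to ∘ f) (strictlyInverseʳ _)) (trans (cong to (fg (from i))) (strictlyInverseˡ i))

    -- Translation by x permutes the field, so it preserves the sum of all elements, yet it adds x
    -- to each of the Q summands.
    order×x≡0 : ∀ x → Q ⨉ x ≡ 0#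
    order×x≡0 x = begin
      Q ⨉ x ≡⟨ solve 2 (λ s t → t := (s :+ t) :- s) refl (Sum.sum from) (Q ⨉ x) ⟩
      (Sum.sum from + Q ⨉ x) - Sum.sum from ≡⟨ x≡y⇒x-y≡0 (sym total) ⟩
      0# ∎
      where
      π = lift (_+ x) (_- x)
        (λ y → solve 2 (λ x y → (y :- x) :+ x := y) refl x y)
        (λ y → solve 2 (λ x y → (y :+ x) :- x := y) refl x y)

      total : Sum.sum from ≡ Sum.sum from + Q ⨉ x
      total = begin
        Sum.sum from ≡⟨ Sum.sum-permute from π ⟩
        Sum.sum (λ i → from (π ⟨$⟩ʳ i)) ≡⟨ Sum.sum-cong-≗ (λ i → strictlyInverseʳ (from i + x)) ⟩
        Sum.sum (λ i → from i + x) ≡⟨ Sum.∑-distrib-+ from (λ _ → x) ⟩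
        Sum.sum from + Sum.sum {Q} (λ _ → x) ≡⟨ cong (Sum.sum from +_) (Sum.sum-replicate Q) ⟩
        Sum.sum from + Q ⨉ x ∎

    -- Multiplication by x permutes the field; comparing the products of the nonzero
    -- elements before and after gives x ^ (Q - 1) ≡ 1.
    x^order≡x : ∀ x → x ^ Q ≡ x
    x^order≡x x with x ≟ 0#
    -- `to 0#` witnesses that Q is positive; with exponent 0 the power would be 1.
    ... | yes refl = 0^ (to 0#)
      where
      0^ : ∀ {n} → Fin n → 0# ^ n ≡ 0#
      0^ {suc n} _ = zeroˡ _
    ... | no x≢0 = begin
      x ^ Q ≡⟨ sym (x*Π-constant-off x (to 0#) (g ∘ from) g0≡1 g≡x) ⟩
      x * Product.sum (g ∘ from) ≡⟨ cong (x *_) (sym (*-cancelˡ (Π-≢0 (h ∘ from) (h≢0 ∘ from)) (trans (*-identityʳ _) total))) ⟩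
      x * 1# ≡⟨ *-identityʳ x ⟩
      x ∎
      where
      -- `h` replaces 0 by 1, so that its product over the field is that of the nonzero elements;
      -- `g` is the factor that `h` gains under multiplication by x.
      h g : Carrier → Carrier
      h y with y ≟ 0#
      ... | yes _ = 1#
      ... | no _ = y
      g y with y ≟ 0#
      ... | yes _ = 1#
      ... | no _ = x

      h≢0 : ∀ y → h y ≢ 0#
      h≢0 y with y ≟ 0#
      ... | yes _ = 1≢0
      ... | no y≢0 = y≢0

      g0≡1 : g (from (to 0#)) ≡ 1#
      g0≡1 with from (to 0#) ≟ 0#
      ... | yes _ = refl
      ... | no ≢0 = contradiction (strictlyInverseʳ 0#) ≢0

      g≡x : ∀ j → j ≢ to 0# → g (from j) ≡ x
      g≡x j j≢ with from j ≟ 0#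
      ... | yes ≡0 = contradiction (trans (sym (strictlyInverseˡ j)) (cong to ≡0)) j≢
      ... | no _ = refl

      h-scale : ∀ y → h (x * y) ≡ h y * g y
      h-scale y with y ≟ 0# | x * y ≟ 0#
      ... | yes _ | yes _ = sym (*-identityˡ 1#)
      ... | yes refl | no ≢0 = contradiction (zeroʳ x) ≢0
      ... | no y≢0 | yes ≡0 = contradiction ≡0 (x*y≢0 x≢0 y≢0)
      ... | no _ | no _ = *-comm x y

      x⁻¹ = proj₁ (inverse x x≢0)
      xx⁻¹≡1 = proj₂ (inverse x x≢0)

      π = lift (x *_) (x⁻¹ *_)
        (λ y → trans (sym (*-assoc x x⁻¹ y)) (trans (cong (_* y) xx⁻¹≡1) (*-identityˡ y)))
        (λ y → trans (sym (*-assoc x⁻¹ x y)) (trans (cong (_* y) (trans (*-comm x⁻¹ x) xx⁻¹≡1)) (*-identityˡ y)))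

      total : Product.sum (h ∘ from) ≡ Product.sum (h ∘ from) * Product.sum (g ∘ from)
      total = begin
        Product.sum (h ∘ from) ≡⟨ Product.sum-permute (h ∘ from) π ⟩
        Product.sum (λ i → h (from (π ⟨$⟩ʳ i)))
          ≡⟨ Product.sum-cong-≗ (λ i → trans (cong h (strictlyInverseʳ _)) (h-scale (from i))) ⟩
        Product.sum (λ i → h (from i) * g (from i)) ≡⟨ Product.∑-distrib-+ (h ∘ from) (g ∘ from) ⟩
        Product.sum (h ∘ from) * Product.sum (g ∘ from) ∎

    -- Off the fixed points, x ^ Q - x = (x ^ n - x) G(x) forces G(x) = 0, and G has degree Q - n.
    fixedPoints : ∀ e j → Q ≡ suc (suc j ℕ.* suc e) → Enumeration (λ x → x ^ (2 ℕ.+ e) ≡ x) (2 ℕ.+ e)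
    fixedPoints e j Q≡ with m , n , E , E′ , m+n≡Q ← enumerate F↔Fin (λ x → x ^ (2 ℕ.+ e) ≟ x)
      = subst (Enumeration _) m≡ E
      where
      open Enumeration
      fixed-root : ∀ x → x ^ (2 ℕ.+ e) ≡ x → evalMonic (0# ∷ - 1# ∷ (replicate e 0# ++ [])) x ≡ 0#
      fixed-root x fixed = begin
        0# + x * (- 1# + x * evalMonic (replicate e 0# ++ []) x)
          ≡⟨ cong (λ t → 0# + x * (- 1# + x * t)) (trans (evalMonic-shift e [] x) (*-identityʳ _)) ⟩
        0# + x * (- 1# + x * x ^ e)
          ≡⟨ +-identityˡ _ ⟩
        x * (- 1# + x * x ^ e)
          ≡⟨ solve 3 (λ o x y → x :* (:- o :+ x :* y) := x :* (x :* y) :- x :* o) refl 1# x (x ^ e) ⟩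
        x ^ (2 ℕ.+ e) - x * 1#
          ≡⟨ x≡y⇒x-y≡0 (trans fixed (sym (*-identityʳ x))) ⟩
        0# ∎

      moved-root : ∀ x → x ^ (2 ℕ.+ e) ≢ x → evalMonic (geometric e j) x ≡ 0#
      moved-root x moved = x*y≡0⇒y≡0 (moved ∘ x-y≡0⇒x≡y) (begin
        (x * X - x) * G ≡⟨ cong (λ t → (x * X - t) * G) (sym (*-identityʳ x)) ⟩
        (x * X - x * 1#) * G ≡⟨ solve 4 (λ o x y g → (x :* y :- x :* o) :* g := x :* ((y :- o) :* g)) refl 1# x X G ⟩
        x * ((X - 1#) * G) ≡⟨ cong (x *_) (geometric-sum e j x) ⟩
        x * (Y - 1#) ≡⟨ solve 3 (λ o x y → x :* (y :- o) := x :* y :- x :* o) refl 1# x Y ⟩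
        x ^ suc (suc j ℕ.* suc e) - x * 1# ≡⟨ x≡y⇒x-y≡0 (trans (cong (x ^_) (sym Q≡)) (trans (x^order≡x x) (sym (*-identityʳ x)))) ⟩
        0# ∎)
        where
        X = x ^ suc e
        Y = x ^ (suc j ℕ.* suc e)
        G = evalMonic (geometric e j) x

      moved≤ = rootCount≤degree (geometric e j) _ (injective E′) (λ i → moved-root _ (elem∈ E′ i))

      -- There are at most n fixed points and at most Q - n others. They add up to Q, so both bounds
      -- are attained.
      m≡ : m ≡ 2 ℕ.+ e
      m≡ = ℕₚ.≤-antisym
        (subst (λ k → m ℕ.≤ 2 ℕ.+ k) (ℕₚ.+-identityʳ e)
          (rootCount≤degree (0# ∷ - 1# ∷ (replicate e 0# ++ [])) _ (injective E) (λ i → fixed-root _ (elem∈ E i))))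
        (ℕₚ.+-cancelʳ-≤ n _ _ (ℕₚ.≤-trans (ℕₚ.+-monoʳ-≤ (2 ℕ.+ e) moved≤) (ℕₚ.≤-reflexive (sym (trans m+n≡Q Q≡)))))

  -- Characteristic and Frobenius.

  x^n≡0⇒x≡0 : ∀ {x} n → Dec (x ≡ 0#) → x ^ n ≡ 0# → x ≡ 0#
  x^n≡0⇒x≡0 n (yes x≡0) _ = x≡0
  x^n≡0⇒x≡0 n (no x≢0) eq = contradiction eq (^-≢0 n x≢0)

  [m^n]⨉1 : ∀ m n → (m ℕ.^ n) ⨉ 1# ≡ (m ⨉ 1#) ^ n
  [m^n]⨉1 m zero = +-identityʳ 1#
  [m^n]⨉1 m (suc n) = trans (×1-homo-* m (m ℕ.^ n)) (cong ((m ⨉ 1#) *_) ([m^n]⨉1 m n))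

  module _ {p} (p-prime : Prime p) (p⨉1≡0 : p ⨉ 1# ≡ 0#) where

    multiple≡0 : ∀ {n} x → p ∣ n → n ⨉ x ≡ 0#
    multiple≡0 x (divides c refl) = begin
      (c ℕ.* p) ⨉ x ≡⟨ cong ((c ℕ.* p) ⨉_) (sym (*-identityˡ x)) ⟩
      (c ℕ.* p) ⨉ (1# * x) ≡⟨ sym (×-assoc-* (c ℕ.* p) 1# x) ⟩
      (c ℕ.* p) ⨉ 1# * x ≡⟨ cong (_* x) (×1-homo-* c p) ⟩
      c ⨉ 1# * p ⨉ 1# * x ≡⟨ cong (λ t → c ⨉ 1# * t * x) p⨉1≡0 ⟩
      c ⨉ 1# * 0# * x ≡⟨ cong (_* x) (zeroʳ _) ⟩
      0# * x ≡⟨ zeroˡ x ⟩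
      0# ∎

    -- All inner terms of the binomial expansion have coefficients divisible by p.
    [x+y]^p≡x^p+y^p : ∀ x y → (x + y) ^ p ≡ x ^ p + y ^ p
    [x+y]^p≡x^p+y^p = expand p-prime multiple≡0
      where
      -- `p` is quantified afresh so that it can be matched as a successor; the vanishing of
      -- multiples of p is carried along as an argument.
      expand : ∀ {p} → Prime p → (∀ {n} x → p ∣ n → n ⨉ x ≡ 0#) → ∀ x y → (x + y) ^ p ≡ x ^ p + y ^ p
      expand {zero} p-prime _ = contradiction p-prime ¬prime[0]
      expand {p@(suc p′)} p-prime multiple≡0 x y = begin
        (x + y) ^ p ≡⟨ binomialTheorem p x y ⟩
        term zero + Sum.sum (term ∘ suc) ≡⟨ cong (term zero +_) (Sum.sum-init-last (term ∘ suc)) ⟩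
        term zero + (Sum.sum (λ i → term (suc (Fin.inject₁ i))) + term (suc (Fin.fromℕ p′)))
          ≡⟨ cong₂ _+_ first (cong₂ _+_ middle last) ⟩
        y ^ p + (0# + x ^ p) ≡⟨ solve 2 (λ x y → y :+ (:0 :+ x) := x :+ y) refl (x ^ p) (y ^ p) ⟩
        x ^ p + y ^ p ∎
        where
        term = binomialTerm x y p

        1⨉ : ∀ z → 1 ⨉ z ≡ z
        1⨉ = +-identityʳ

        first : term zero ≡ y ^ p
        first = trans (1⨉ _) (*-identityˡ _)

        middle : Sum.sum (λ i → term (suc (Fin.inject₁ i))) ≡ 0#
        middle = trans (Sum.sum-cong-≗ {p′} λ i → multiple≡0 _ (prime∣binomial p-prime
            (subst (ℕ._< p′) (sym (Finₚ.toℕ-inject₁ i)) (Finₚ.toℕ<n i))))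
          (Sum.sum-replicate-zero p′)

        last : term (suc (Fin.fromℕ p′)) ≡ x ^ p
        last = begin
          (p C suc (Fin.toℕ (Fin.fromℕ p′))) ⨉ (x ^ suc (Fin.toℕ (Fin.fromℕ p′)) * y ^ (p′ ℕ.∸ Fin.toℕ (Fin.fromℕ p′)))
            ≡⟨ cong (λ k → (p C suc k) ⨉ (x ^ suc k * y ^ (p′ ℕ.∸ k))) (Finₚ.toℕ-fromℕ p′) ⟩
          (p C p) ⨉ (x ^ p * y ^ (p′ ℕ.∸ p′))
            ≡⟨ cong₂ (λ k l → k ⨉ (x ^ p * y ^ l)) (nCn≡1 p) (ℕₚ.n∸n≡0 p′) ⟩
          1 ⨉ (x ^ p * 1#)
            ≡⟨ trans (1⨉ _) (*-identityʳ _) ⟩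
          x ^ p ∎

  Additive : (Carrier → Carrier) → Set
  Additive f = ∀ x y → f (x + y) ≡ f x + f y

  frobenius-additive : ∀ {p} → Additive (_^ p) → ∀ n → Additive (_^ (p ℕ.^ n))
  frobenius-additive {p} add zero x y = trans (*-identityʳ _) (sym (cong₂ _+_ (*-identityʳ x) (*-identityʳ y)))
  frobenius-additive {p} add (suc n) x y = begin
    (x + y) ^ (p ℕ.* p ℕ.^ n) ≡⟨ sym (^-assocʳ (x + y) p (p ℕ.^ n)) ⟩
    ((x + y) ^ p) ^ (p ℕ.^ n) ≡⟨ cong (_^ (p ℕ.^ n)) (add x y) ⟩
    (x ^ p + y ^ p) ^ (p ℕ.^ n) ≡⟨ frobenius-additive add n (x ^ p) (y ^ p) ⟩
    (x ^ p) ^ (p ℕ.^ n) + (y ^ p) ^ (p ℕ.^ n) ≡⟨ cong₂ _+_ (^-assocʳ x p _) (^-assocʳ y p _) ⟩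
    x ^ (p ℕ.* p ℕ.^ n) + y ^ (p ℕ.* p ℕ.^ n) ∎

  -- The order pⁿ annihilates 1, and pⁿ · 1 is the n-th power of p · 1; a field has no nonzero
  -- nilpotents.
  characteristic : ∀ p n → HasOrder F (p ℕ.^ n) → p ⨉ 1# ≡ 0#
  characteristic p n F↔Fin = x^n≡0⇒x≡0 n (_ ≟ 0#) (trans (sym ([m^n]⨉1 p n)) (order×x≡0 1#))
    where open Finite F↔Fin

  -- Subfields as fixed points of Frobenius maps.

  record IsSubfield (P : Pred Carrier 0ℓ) : Set where
    field
      0∈ : P 0#
      1∈ : P 1#
      +∈ : ∀ {x y} → P x → P y → P (x + y)
      -∈ : ∀ {x} → P x → P (- x)
      *∈ : ∀ {x y} → P x → P y → P (x * y)
      -- Closure under division, with y as the quotient of `x * y` by `x`, so that no inverse has to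
      -- be named.
      ÷∈ : ∀ {x y} → x ≢ 0# → P x → P (x * y) → P y

    minus∈ : ∀ {x y} → P x → P y → P (x - y)
    minus∈ x∈ y∈ = +∈ x∈ (-∈ y∈)

  -- Powers are multiplicative, so additivity makes this power map a field endomorphism, and the
  -- fixed points of an endomorphism form a subfield. The exponent is positive so that 0 is fixed.
  fixed-isSubfield : ∀ n → Additive (_^ suc n) → IsSubfield (λ x → x ^ suc n ≡ x)
  fixed-isSubfield n add = record
    { 0∈ = zeroˡ _
    ; 1∈ = 1^n≡1 (suc n)
    ; +∈ = λ {x} {y} x∈ y∈ → trans (add x y) (cong₂ _+_ x∈ y∈)
    -- Additivity at x and -x settles the sign without regard to the parity of the exponent.
    ; -∈ = λ {x} x∈ → begin
        (- x) ^ s ≡⟨ solve 2 (λ z y → z := (y :+ z) :- y) refl _ x ⟩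
        (x + (- x) ^ s) - x ≡⟨ cong (λ t → (t + (- x) ^ s) - x) (sym x∈) ⟩
        (x ^ s + (- x) ^ s) - x ≡⟨ cong (_- x) (sym (add x (- x))) ⟩
        (x - x) ^ s - x ≡⟨ cong (_- x) (trans (cong (_^ s) (-‿inverseʳ x)) (zeroˡ _)) ⟩
        0# - x ≡⟨ +-identityˡ _ ⟩
        - x ∎
    ; *∈ = λ {x} {y} x∈ y∈ → trans (^-distrib-* x y s) (cong₂ _*_ x∈ y∈)
    ; ÷∈ = λ {x} {y} x≢0 x∈ xy∈ → *-cancelˡ x≢0
        (trans (cong (_* y ^ s) (sym x∈)) (trans (sym (^-distrib-* x y s)) xy∈))
    }
    where
    s = suc n

-- Linear algebra in F³.

module Vectors (F : Field) (_≟_ : (x y : Field.Carrier F) → Dec (x ≡ y)) where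
  open FieldTheory F
  open Projective F

  vec-≡ : ∀ {x y z x′ y′ z′} → x ≡ x′ → y ≡ y′ → z ≡ z′ → ⟨ x , y , z ⟩ ≡ ⟨ x′ , y′ , z′ ⟩
  vec-≡ refl refl refl = refl

  infix 7 _∙_
  _∙_ : Vec3 → Vec3 → Carrier
  ⟨ x , y , z ⟩ ∙ ⟨ x′ , y′ , z′ ⟩ = x * x′ + y * y′ + z * z′

  _⊗_ : Vec3 → Vec3 → Vec3
  ⟨ x , y , z ⟩ ⊗ ⟨ x′ , y′ , z′ ⟩ = ⟨ y * z′ - z * y′ , z * x′ - x * z′ , x * y′ - y * x′ ⟩

  infix 4 _∈³_
  _∈³_ : Vec3 → Pred Carrier 0ℓ → Set
  ⟨ x , y , z ⟩ ∈³ P = P x × P y × P z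

  ·-∙ : ∀ t u v → (t · u) ∙ v ≡ t * (u ∙ v)
  ·-∙ t ⟨ x , y , z ⟩ ⟨ x′ , y′ , z′ ⟩ =
    solve 7 (λ t x y z x′ y′ z′ → t :* x :* x′ :+ t :* y :* y′ :+ t :* z :* z′ := t :* (x :* x′ :+ y :* y′ :+ z :* z′))
      refl t x y z x′ y′ z′

  ∙-comm : ∀ u v → u ∙ v ≡ v ∙ u
  ∙-comm ⟨ x , y , z ⟩ ⟨ x′ , y′ , z′ ⟩ = cong₂ _+_ (cong₂ _+_ (*-comm x x′) (*-comm y y′)) (*-comm z z′)

  -- The case distinction on which coordinate is nonzero happens here once; later proofs multiply by
  -- `e ∙ v`, which is 1.
  dual-vector : ∀ v → v ≢ zero3 → ∃ λ e → e ∙ v ≡ 1#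
  dual-vector ⟨ x , y , z ⟩ v≢0 with x ≟ 0# | y ≟ 0# | z ≟ 0#
  ... | yes refl | yes refl | yes refl = contradiction refl v≢0
  ... | no x≢0 | _ | _ = let w , xw≡1 = inverse x x≢0 in ⟨ w , 0# , 0# ⟩ , (begin
    w * x + 0# * y + 0# * z ≡⟨ cong₂ _+_ (cong₂ _+_ (trans (*-comm w x) xw≡1) (zeroˡ y)) (zeroˡ z) ⟩
    1# + 0# + 0# ≡⟨ trans (+-identityʳ _) (+-identityʳ _) ⟩
    1# ∎)
  ... | yes _ | no y≢0 | _ = let w , yw≡1 = inverse y y≢0 in ⟨ 0# , w , 0# ⟩ , (begin
    0# * x + w * y + 0# * z ≡⟨ cong₂ _+_ (cong₂ _+_ (zeroˡ x) (trans (*-comm w y) yw≡1)) (zeroˡ z) ⟩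
    0# + 1# + 0# ≡⟨ trans (+-identityʳ _) (+-identityˡ _) ⟩
    1# ∎)
  ... | yes _ | yes _ | no z≢0 = let w , zw≡1 = inverse z z≢0 in ⟨ 0# , 0# , w ⟩ , (begin
    0# * x + 0# * y + w * z ≡⟨ cong₂ _+_ (cong₂ _+_ (zeroˡ x) (zeroˡ y)) (trans (*-comm w z) zw≡1) ⟩
    0# + 0# + 1# ≡⟨ trans (cong (_+ 1#) (+-identityˡ _)) (+-identityˡ _) ⟩
    1# ∎)

  -- The triple product expansion writes (e ∙ u) v as (e ∙ v) u plus terms containing coordinates of
  -- `u ⊗ v`. Choosing e with e ∙ u = 1 leaves the scalar e ∙ v.
  ⊗≡0⇒parallel : ∀ u v → u ≢ zero3 → u ⊗ v ≡ zero3 → ∃ λ t → v ≡ t · u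
  ⊗≡0⇒parallel u@(⟨ x , y , z ⟩) v@(⟨ x′ , y′ , z′ ⟩) u≢0 uv≡0
    with e@(⟨ a , b , c ⟩) , eu≡1 ← dual-vector u u≢0
    = e ∙ v , vec-≡
      (collinear x x′ (cong Vec3.y uv≡0) (cong Vec3.z uv≡0)
        (solve 9 (λ x y z x′ y′ z′ a b c → x′ :* (a :* x :+ b :* y :+ c :* z) :=
          (a :* x′ :+ b :* y′ :+ c :* z′) :* x :+ ((z :* x′ :- x :* z′) :* c :- (x :* y′ :- y :* x′) :* b)) refl x y z x′ y′ z′ a b c))
      (collinear y y′ (cong Vec3.z uv≡0) (cong Vec3.x uv≡0)
        (solve 9 (λ x y z x′ y′ z′ a b c → y′ :* (a :* x :+ b :* y :+ c :* z) :=
          (a :* x′ :+ b :* y′ :+ c :* z′) :* y :+ ((x :* y′ :- y :* x′) :* a :- (y :* z′ :- z :* y′) :* c)) refl x y z x′ y′ z′ a b c))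
      (collinear z z′ (cong Vec3.x uv≡0) (cong Vec3.y uv≡0)
        (solve 9 (λ x y z x′ y′ z′ a b c → z′ :* (a :* x :+ b :* y :+ c :* z) :=
          (a :* x′ :+ b :* y′ :+ c :* z′) :* z :+ ((y :* z′ :- z :* y′) :* b :- (z :* x′ :- x :* z′) :* a)) refl x y z x′ y′ z′ a b c))
    where
    collinear : ∀ p q {r s t t′} → r ≡ 0# → s ≡ 0# → q * (e ∙ u) ≡ (e ∙ v) * p + (r * t - s * t′) → q ≡ (e ∙ v) * p
    collinear p q {r} {s} {t} {t′} refl refl eq = begin
      q ≡⟨ sym (*-identityʳ q) ⟩
      q * 1# ≡⟨ cong (q *_) (sym eu≡1) ⟩
      q * (e ∙ u) ≡⟨ eq ⟩
      (e ∙ v) * p + (0# * t - 0# * t′) ≡⟨ solve 3 (λ m t t′ → m :+ (:0 :* t :- :0 :* t′) := m) refl ((e ∙ v) * p) t t′ ⟩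
      (e ∙ v) * p ∎

  parallel⇒⊗≡0 : ∀ s t v → (s · v) ⊗ (t · v) ≡ zero3
  parallel⇒⊗≡0 s t ⟨ x , y , z ⟩ = vec-≡ (minor y z) (minor z x) (minor x y)
    where
    minor : ∀ x y → (s * x) * (t * y) - (s * y) * (t * x) ≡ 0#
    minor x y = solve 4 (λ s t x y → (s :* x) :* (t :* y) :- (s :* y) :* (t :* x) := :0) refl s t x y

  private
    -- The determinant x ∙ (y ⊗ z) as a solver expression.
    :triple : ∀ {n} (x₁ x₂ x₃ y₁ y₂ y₃ z₁ z₂ z₃ : Polynomial n) → Polynomial n
    :triple x₁ x₂ x₃ y₁ y₂ y₃ z₁ z₂ z₃ =
      x₁ :* (y₂ :* z₃ :- y₃ :* z₂) :+ x₂ :* (y₃ :* z₁ :- y₁ :* z₃) :+ x₃ :* (y₁ :* z₂ :- y₂ :* z₁)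

  module _ (u p a b : Vec3) (u≢0 : u ≢ zero3) (up≡0 : u ∙ p ≡ 0#) (ua≡0 : u ∙ a ≡ 0#) (ub≡0 : u ∙ b ≡ 0#) where
    open Vec3 u renaming (x to u₁; y to u₂; z to u₃)
    open Vec3 p renaming (x to p₁; y to p₂; z to p₃)
    open Vec3 a renaming (x to a₁; y to a₂; z to a₃)
    open Vec3 b renaming (x to b₁; y to b₂; z to b₃)

    -- Writing det(p,a,b) e as a combination of p, a, b by Cramer's rule and pairing with u makes
    -- every term vanish, while e ∙ u = 1.
    det≡0 : p ∙ (a ⊗ b) ≡ 0#
    det≡0 with e@(⟨ e₁ , e₂ , e₃ ⟩) , eu≡1 ← dual-vector u u≢0 = begin
      p ∙ (a ⊗ b) ≡⟨ sym (*-identityˡ _) ⟩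
      1# * (p ∙ (a ⊗ b)) ≡⟨ cong (_* (p ∙ (a ⊗ b))) (sym eu≡1) ⟩
      (e ∙ u) * (p ∙ (a ⊗ b))
        ≡⟨ solve 15 (λ e₁ e₂ e₃ u₁ u₂ u₃ p₁ p₂ p₃ a₁ a₂ a₃ b₁ b₂ b₃ →
             (e₁ :* u₁ :+ e₂ :* u₂ :+ e₃ :* u₃) :* :triple p₁ p₂ p₃ a₁ a₂ a₃ b₁ b₂ b₃ :=
             (u₁ :* p₁ :+ u₂ :* p₂ :+ u₃ :* p₃) :* :triple e₁ e₂ e₃ a₁ a₂ a₃ b₁ b₂ b₃
             :+ (u₁ :* a₁ :+ u₂ :* a₂ :+ u₃ :* a₃) :* :triple e₁ e₂ e₃ b₁ b₂ b₃ p₁ p₂ p₃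
             :+ (u₁ :* b₁ :+ u₂ :* b₂ :+ u₃ :* b₃) :* :triple e₁ e₂ e₃ p₁ p₂ p₃ a₁ a₂ a₃)
           refl e₁ e₂ e₃ u₁ u₂ u₃ p₁ p₂ p₃ a₁ a₂ a₃ b₁ b₂ b₃ ⟩
      (u ∙ p) * (e ∙ (a ⊗ b)) + (u ∙ a) * (e ∙ (b ⊗ p)) + (u ∙ b) * (e ∙ (p ⊗ a))
        ≡⟨ vanish _ _ _ up≡0 ua≡0 ub≡0 ⟩
      0# ∎
      where
      vanish : ∀ {r s t} x y z → r ≡ 0# → s ≡ 0# → t ≡ 0# → r * x + s * y + t * z ≡ 0#
      vanish x y z refl refl refl = solve 3 (λ x y z → :0 :* x :+ :0 :* y :+ :0 :* z := :0) refl x y z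

    -- Cramer's rule in the basis e, a, b with det(e,a,b) = 1: the coefficient of e is det(p,a,b),
    -- which is 0.
    ∈-span : a ⊗ b ≢ zero3 → ∃₂ λ α β → p ≡ (α · a) ⊕ (β · b)
    ∈-span ab≢0 with e@(⟨ e₁ , e₂ , e₃ ⟩) , e∙ab≡1 ← dual-vector (a ⊗ b) ab≢0
      = e ∙ (p ⊗ b) , e ∙ (a ⊗ p) , vec-≡
        (coordinate (solve 12 (λ e₁ e₂ e₃ p₁ p₂ p₃ a₁ a₂ a₃ b₁ b₂ b₃ →
          p₁ :* :triple e₁ e₂ e₃ a₁ a₂ a₃ b₁ b₂ b₃ :=
          :triple e₁ e₂ e₃ p₁ p₂ p₃ b₁ b₂ b₃ :* a₁ :+ :triple e₁ e₂ e₃ a₁ a₂ a₃ p₁ p₂ p₃ :* b₁ :+ e₁ :* :triple p₁ p₂ p₃ a₁ a₂ a₃ b₁ b₂ b₃)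
          refl e₁ e₂ e₃ p₁ p₂ p₃ a₁ a₂ a₃ b₁ b₂ b₃))
        (coordinate (solve 12 (λ e₁ e₂ e₃ p₁ p₂ p₃ a₁ a₂ a₃ b₁ b₂ b₃ →
          p₂ :* :triple e₁ e₂ e₃ a₁ a₂ a₃ b₁ b₂ b₃ :=
          :triple e₁ e₂ e₃ p₁ p₂ p₃ b₁ b₂ b₃ :* a₂ :+ :triple e₁ e₂ e₃ a₁ a₂ a₃ p₁ p₂ p₃ :* b₂ :+ e₂ :* :triple p₁ p₂ p₃ a₁ a₂ a₃ b₁ b₂ b₃)
          refl e₁ e₂ e₃ p₁ p₂ p₃ a₁ a₂ a₃ b₁ b₂ b₃))
        (coordinate (solve 12 (λ e₁ e₂ e₃ p₁ p₂ p₃ a₁ a₂ a₃ b₁ b₂ b₃ →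
          p₃ :* :triple e₁ e₂ e₃ a₁ a₂ a₃ b₁ b₂ b₃ :=
          :triple e₁ e₂ e₃ p₁ p₂ p₃ b₁ b₂ b₃ :* a₃ :+ :triple e₁ e₂ e₃ a₁ a₂ a₃ p₁ p₂ p₃ :* b₃ :+ e₃ :* :triple p₁ p₂ p₃ a₁ a₂ a₃ b₁ b₂ b₃)
          refl e₁ e₂ e₃ p₁ p₂ p₃ a₁ a₂ a₃ b₁ b₂ b₃))
      where
      coordinate : ∀ {x y t} → x * (e ∙ (a ⊗ b)) ≡ y + t * (p ∙ (a ⊗ b)) → x ≡ y
      coordinate {x} {y} {t} eq = begin
        x ≡⟨ sym (*-identityʳ x) ⟩
        x * 1# ≡⟨ cong (x *_) (sym e∙ab≡1) ⟩
        x * (e ∙ (a ⊗ b)) ≡⟨ eq ⟩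
        y + t * (p ∙ (a ⊗ b)) ≡⟨ cong (λ d → y + t * d) det≡0 ⟩
        y + t * 0# ≡⟨ trans (cong (y +_) (zeroʳ t)) (+-identityʳ y) ⟩
        y ∎

  ·-≢0 : ∀ {t v} → t · v ≢ zero3 → t ≢ 0#
  ·-≢0 {v = ⟨ x , y , z ⟩} tv≢0 refl = tv≢0 (vec-≡ (zeroˡ x) (zeroˡ y) (zeroˡ z))

  onLine : ∀ {u} ((p , p≢0) (a , a≢0) (b , b≢0) : Point) → u ≢ zero3 →
    u ∙ p ≡ 0# → u ∙ a ≡ 0# → u ∙ b ≡ 0# → ¬ ((a , a≢0) ∼ (b , b≢0)) → OnLine (p , p≢0) (a , a≢0) (b , b≢0)
  onLine {u} (p , _) (a , a≢0) (b , b≢0) u≢0 up ua ub a≁b = a≁b , ∈-span u p a b u≢0 up ua ub λ ab≡0 →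
    let t , b≡ta = ⊗≡0⇒parallel a b a≢0 ab≡0
    in a≁b (t , ·-≢0 (b≢0 ∘ trans b≡ta) , b≡ta)

  -- Pigeonhole: there are more coefficient vectors than values.
  dependent : ∀ {P R : Pred Carrier 0ℓ} {m n} → Enumeration P m → Enumeration R n → IsSubfield P →
    n ℕ.< m ℕ.* (m ℕ.* m) → ∀ v → (∀ {a} → a ∈³ P → R (a ∙ v)) → ∃ λ a → a ∈³ P × a ≢ zero3 × a ∙ v ≡ 0#
  dependent {P} {R} {m} E E′ P-sub n<m³ v@(⟨ x , y , z ⟩) R∋ =
    let i , j , i<j , eq = Finₚ.pigeonhole n<m³ (λ i → index E′ (R∋ (vec∈ i))) in
    _ , (minus∈ (elem∈ E _) (elem∈ E _) , minus∈ (elem∈ E _) (elem∈ E _) , minus∈ (elem∈ E _) (elem∈ E _))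
    , (λ ≡0 → Finₚ.<⇒≢ i<j (digits-injective
        (injective E (x-y≡0⇒x≡y (cong Vec3.x ≡0)))
        (injective E (x-y≡0⇒x≡y (cong Vec3.y ≡0)))
        (injective E (x-y≡0⇒x≡y (cong Vec3.z ≡0)))))
    , (begin
      _
        ≡⟨ solve 9 (λ a b c a′ b′ c′ x y z → (a :- a′) :* x :+ (b :- b′) :* y :+ (c :- c′) :* z :=
             (a :* x :+ b :* y :+ c :* z) :- (a′ :* x :+ b′ :* y :+ c′ :* z)) refl _ _ _ _ _ _ x y z ⟩
      vec i ∙ v - vec j ∙ v ≡⟨ x≡y⇒x-y≡0 (index-injective E′ (R∋ (vec∈ i)) (R∋ (vec∈ j)) eq) ⟩
      0# ∎)
    where
    open Enumeration
    open IsSubfield P-sub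
    digit₁ digit₂ digit₃ : Fin (m ℕ.* (m ℕ.* m)) → Fin m
    digit₁ = proj₁ ∘ Fin.remQuot (m ℕ.* m)
    digit₂ = proj₁ ∘ Fin.remQuot m ∘ proj₂ ∘ Fin.remQuot {m} (m ℕ.* m)
    digit₃ = proj₂ ∘ Fin.remQuot {m} m ∘ proj₂ ∘ Fin.remQuot {m} (m ℕ.* m)

    combine-digits : ∀ i → Fin.combine (digit₁ i) (Fin.combine (digit₂ i) (digit₃ i)) ≡ i
    combine-digits i = trans (cong (Fin.combine (digit₁ i)) (Finₚ.combine-remQuot {m} m _)) (Finₚ.combine-remQuot {m} (m ℕ.* m) i)

    digits-injective : ∀ {i j} → digit₁ i ≡ digit₁ j → digit₂ i ≡ digit₂ j → digit₃ i ≡ digit₃ j → i ≡ j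
    digits-injective {i} {j} eq₁ eq₂ eq₃ = trans (sym (combine-digits i))
      (trans (cong₂ Fin.combine eq₁ (cong₂ Fin.combine eq₂ eq₃)) (combine-digits j))

    vec : Fin (m ℕ.* (m ℕ.* m)) → Vec3
    vec i = ⟨ elem E (digit₁ i) , elem E (digit₂ i) , elem E (digit₃ i) ⟩

    vec∈ : ∀ i → vec i ∈³ P
    vec∈ i = elem∈ E _ , elem∈ E _ , elem∈ E _

-- Two disjoint Baer subplanes and the lines joining them.

module _ (F : Field) (_≟_ : (x y : Field.Carrier F) → Dec (x ≡ y)) where
  open FieldTheory F
  open Projective F
  open Vectors F _≟_

  module DisjointSubplanes
    {K k : Pred Carrier 0ℓ} (K-sub : IsSubfield K) (k-sub : IsSubfield k) (k⊆K : k ⊆ K)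
    {s : ℕ} (k-enum : Enumeration k s)
    {ω c : Carrier} (ω∈K : K ω) (ω∉k : ¬ k ω) (c∈k : k c)
    (rootless : ∀ {t} → K t → t * (t * t) - t ≢ c)
    where

    open Enumeration k-enum
    private
      module 𝕂 = IsSubfield K-sub
      module 𝕜 = IsSubfield k-sub

    B : Vec3 → Vec3
    B ⟨ x , y , z ⟩ = ⟨ y , z , c * x + y ⟩

    M : Vec3 → Vec3
    M v = v ⊕ (ω · B v)

    Mᵗ : Vec3 → Vec3
    Mᵗ ⟨ x , y , z ⟩ = ⟨ x + ω * (c * z) , ω * x + y + ω * z , ω * y + z ⟩

    -- The line u passes through `M v` exactly when the line `Mᵗ u` passes through v, so meeting the
    -- second subplane reduces to meeting the first.
    ∙-M : ∀ u v → u ∙ M v ≡ v ∙ Mᵗ u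
    ∙-M ⟨ x , y , z ⟩ ⟨ x′ , y′ , z′ ⟩ = solve 8 (λ ω c x y z x′ y′ z′ →
      x :* (x′ :+ ω :* y′) :+ y :* (y′ :+ ω :* z′) :+ z :* (z′ :+ ω :* (c :* x′ :+ y′))
      := x′ :* (x :+ ω :* (c :* z)) :+ y′ :* (ω :* x :+ y :+ ω :* z) :+ z′ :* (ω :* y :+ z)) refl ω c x y z x′ y′ z′

    Mᵗ-∈ : ∀ {v} → v ∈³ K → Mᵗ v ∈³ K
    Mᵗ-∈ (x∈ , y∈ , z∈) =
      𝕂.+∈ x∈ (𝕂.*∈ ω∈K (𝕂.*∈ (k⊆K c∈k) z∈)) ,
      𝕂.+∈ (𝕂.+∈ (𝕂.*∈ ω∈K x∈) y∈) (𝕂.*∈ ω∈K z∈) ,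
      𝕂.+∈ (𝕂.*∈ ω∈K y∈) z∈

    B-∈ : ∀ {v} → v ∈³ k → B v ∈³ k
    B-∈ (x∈ , y∈ , z∈) = y∈ , z∈ , 𝕜.+∈ (𝕜.*∈ c∈k x∈) y∈

    M-∈ : ∀ {v} → v ∈³ k → M v ∈³ K
    M-∈ v∈@(x∈ , y∈ , z∈) with x∈′ , y∈′ , z∈′ ← B-∈ v∈ = entry x∈ x∈′ , entry y∈ y∈′ , entry z∈ z∈′
      where
      entry : ∀ {x y} → k x → k y → K (x + ω * y)
      entry x∈ y∈ = 𝕂.+∈ (k⊆K x∈) (𝕂.*∈ ω∈K (k⊆K y∈))

    -- An eigenvalue of B is a root of t³ - t - c.
    B-no-eigenvector : ∀ {v t} → v ∈³ k → B v ≡ t · v → v ≡ zero3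
    B-no-eigenvector {⟨ x , y , z ⟩} {t} (x∈ , y∈ , z∈) eq with x ≟ 0#
    ... | yes refl = vec-≡ refl y≡0 (trans (cong Vec3.y eq) (trans (cong (t *_) y≡0) (zeroʳ t)))
      where
      y≡0 = trans (cong Vec3.x eq) (zeroʳ t)
    ... | no x≢0 = contradiction root (rootless (k⊆K t∈))
      where
      y≡ = cong Vec3.x eq
      -- A priori t is any scalar of F, while `rootless` speaks of K only; t = y / x places it in k.
      t∈ : k t
      t∈ = 𝕜.÷∈ x≢0 x∈ (subst k (trans y≡ (*-comm t x)) y∈)
      root : t * (t * t) - t ≡ c
      root = *-cancelˡ x≢0 (begin
        x * (t * (t * t) - t)
          ≡⟨ solve 2 (λ x t → x :* (t :* (t :* t) :- t) := t :* (t :* (t :* x)) :- t :* x) refl x t ⟩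
        t * (t * (t * x)) - t * x
          ≡⟨ cong (λ y → t * (t * y) - y) (sym y≡) ⟩
        t * (t * y) - y
          ≡⟨ cong (λ z → t * z - y) (sym (cong Vec3.y eq)) ⟩
        t * z - y
          ≡⟨ cong (_- y) (sym (cong Vec3.z eq)) ⟩
        c * x + y - y
          ≡⟨ solve 3 (λ c x y → c :* x :+ y :- y := x :* c) refl c x y ⟩
        x * c ∎)

    ω≢0 : ω ≢ 0#
    ω≢0 refl = ω∉k 𝕜.0∈

    -- Otherwise ω = (x′ - x) / (y - y′) would lie in k.
    1,ω-independent : ∀ {x y x′ y′} → k x → k y → k x′ → k y′ → x + ω * y ≡ x′ + ω * y′ → x ≡ x′ × y ≡ y′
    1,ω-independent {x} {y} {x′} {y′} x∈ y∈ x′∈ y′∈ eq with y ≟ y′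
    ... | yes refl = x-y≡0⇒x≡y (begin
        x - x′ ≡⟨ solve 3 (λ x x′ z → x :- x′ := (x :+ z) :- (x′ :+ z)) refl x x′ (ω * y) ⟩
        (x + ω * y) - (x′ + ω * y) ≡⟨ x≡y⇒x-y≡0 eq ⟩
        0# ∎) , refl
    ... | no y≢y′ = contradiction
      (𝕜.÷∈ (y≢y′ ∘ x-y≡0⇒x≡y) (𝕜.minus∈ y∈ y′∈) (subst k (sym (x-y≡0⇒x≡y (begin
        (y - y′) * ω - (x′ - x)
          ≡⟨ solve 5 (λ x y x′ y′ ω → (y :- y′) :* ω :- (x′ :- x) := (x :+ ω :* y) :- (x′ :+ ω :* y′)) refl x y x′ y′ ω ⟩
        (x + ω * y) - (x′ + ω * y′) ≡⟨ x≡y⇒x-y≡0 eq ⟩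
        0# ∎))) (𝕜.minus∈ x′∈ x∈))) ω∉k

    -- `M v = 0` means B v = t v with t = -1/ω in K, hence (t³ - t - c) x = 0, and t is no root. The
    -- vector ranges over all of F³ because proportionality factors are taken from F.
    M-kernel : ∀ v → M v ≡ zero3 → v ≡ zero3
    M-kernel ⟨ x , y , z ⟩ eq with w , ωw≡1 ← inverse ω ω≢0 = vec-≡ x≡0 y≡0 z≡0
      where
      t = - w
      t∈ : K t
      t∈ = 𝕂.-∈ (𝕂.÷∈ ω≢0 ω∈K (subst K (sym ωw≡1) 𝕂.1∈))

      step : ∀ {a b} → a + ω * b ≡ 0# → b ≡ t * a
      step {a} {b} eq = begin
        b ≡⟨ sym (*-identityˡ b) ⟩
        1# * b ≡⟨ cong (_* b) (sym ωw≡1) ⟩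
        ω * w * b ≡⟨ solve 4 (λ ω w a b → ω :* w :* b := (:- w) :* a :+ w :* (a :+ ω :* b)) refl ω w a b ⟩
        t * a + w * (a + ω * b) ≡⟨ cong (λ r → t * a + w * r) eq ⟩
        t * a + w * 0# ≡⟨ trans (cong (t * a +_) (zeroʳ w)) (+-identityʳ _) ⟩
        t * a ∎

      y≡ : y ≡ t * x
      y≡ = step (cong Vec3.x eq)
      z≡ : z ≡ t * y
      z≡ = step (cong Vec3.y eq)
      x≡0 : x ≡ 0#
      x≡0 = x*y≡0⇒y≡0 {t * (t * t) - t - c} (rootless t∈ ∘ x-y≡0⇒x≡y) (begin
        (t * (t * t) - t - c) * x
          ≡⟨ solve 3 (λ c x t → (t :* (t :* t) :- t :- c) :* x := t :* (t :* (t :* x)) :- (c :* x :+ t :* x)) refl c x t ⟩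
        t * (t * (t * x)) - (c * x + t * x)
          ≡⟨ cong (λ y → t * (t * y) - (c * x + y)) (sym y≡) ⟩
        t * (t * y) - (c * x + y)
          ≡⟨ cong (λ z → t * z - (c * x + y)) (sym z≡) ⟩
        t * z - (c * x + y)
          ≡⟨ x≡y⇒x-y≡0 (sym (step (cong Vec3.z eq))) ⟩
        0# ∎)
      y≡0 : y ≡ 0#
      y≡0 = trans y≡ (trans (cong (t *_) x≡0) (zeroʳ t))
      z≡0 : z ≡ 0#
      z≡0 = trans z≡ (trans (cong (t *_) y≡0) (zeroʳ t))

    M-injective : ∀ t u v → M u ≡ t · M v → u ≡ t · v
    M-injective t ⟨ x , y , z ⟩ ⟨ x′ , y′ , z′ ⟩ eq =
      vec-≡ (x-y≡0⇒x≡y (cong Vec3.x difference≡0)) (x-y≡0⇒x≡y (cong Vec3.y difference≡0)) (x-y≡0⇒x≡y (cong Vec3.z difference≡0))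
      where
      difference≡0 : ⟨ x - t * x′ , y - t * y′ , z - t * z′ ⟩ ≡ zero3
      difference≡0 = M-kernel _ (vec-≡
        (trans (entry x x′ y y′) (x≡y⇒x-y≡0 (cong Vec3.x eq)))
        (trans (entry y y′ z z′) (x≡y⇒x-y≡0 (cong Vec3.y eq)))
        (trans (solve 8 (λ ω c t x x′ y y′ z → z :+ ω :* (c :* (x :- t :* x′) :+ (y :- t :* y′)) := z :+ ω :* ((c :* x :+ y) :- t :* (c :* x′ :+ y′)))
                refl ω c t x x′ y y′ (z - t * z′))
          (trans (entry z z′ (c * x + y) (c * x′ + y′)) (x≡y⇒x-y≡0 (cong Vec3.z eq)))))
        where
        entry : ∀ a a′ b b′ → (a - t * a′) + ω * (b - t * b′) ≡ (a + ω * b) - t * (a′ + ω * b′)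
        entry a a′ b b′ = solve 6 (λ ω t a a′ b b′ →
          (a :- t :* a′) :+ ω :* (b :- t :* b′) := (a :+ ω :* b) :- t :* (a′ :+ ω :* b′)) refl ω t a a′ b b′

    -- If M v = v + ω B v is proportional to a ∈ k³, comparing the coefficients of 1 and ω shows
    -- that v and B v are both proportional to a, so that v is an eigenvector of B.
    disjoint : ∀ {a v t} → a ∈³ k → v ∈³ k → a ≢ zero3 → v ≢ zero3 → M v ≢ t · a
    disjoint {a@(⟨ a₁ , a₂ , a₃ ⟩)} {v@(⟨ x , y , z ⟩)} {t} a∈@(a₁∈ , a₂∈ , a₃∈) v∈@(x∈ , y∈ , z∈) a≢0 v≢0 eq =
      let μ , v≡μa = ⊗≡0⇒parallel a v a≢0 (vec-≡ (proj₁ yz) (proj₁ zx) (proj₁ xy))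
          ν , Bv≡νa = ⊗≡0⇒parallel a (B v) a≢0 (vec-≡ (proj₂ yz) (proj₂ zx) (proj₂ xy))
          ρ , Bv≡ρv = ⊗≡0⇒parallel v (B v) v≢0 (trans (cong₂ _⊗_ v≡μa Bv≡νa) (parallel⇒⊗≡0 μ ν a))
      in v≢0 (B-no-eigenvector v∈ Bv≡ρv)
      where
      z′ = c * x + y
      z′∈ : k z′
      z′∈ = proj₂ (proj₂ (B-∈ v∈))

      -- Cross-multiplication eliminates t, which may lie outside K, and leaves an equation whose
      -- coefficients of 1 and ω are in k.
      compare : ∀ {p q p′ q′ r r′} → k p → k q → k p′ → k q′ → k r → k r′ →
        p + ω * q ≡ t * r → p′ + ω * q′ ≡ t * r′ → (r * p′ - r′ * p ≡ 0#) × (r * q′ - r′ * q ≡ 0#)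
      compare {p} {q} {p′} {q′} {r} {r′} p∈ q∈ p′∈ q′∈ r∈ r′∈ e e′ =
        map x≡y⇒x-y≡0 x≡y⇒x-y≡0 (1,ω-independent (𝕜.*∈ r∈ p′∈) (𝕜.*∈ r∈ q′∈) (𝕜.*∈ r′∈ p∈) (𝕜.*∈ r′∈ q∈) (begin
          r * p′ + ω * (r * q′) ≡⟨ solve 4 (λ ω r p q → r :* p :+ ω :* (r :* q) := r :* (p :+ ω :* q)) refl ω r p′ q′ ⟩
          r * (p′ + ω * q′) ≡⟨ cong (r *_) e′ ⟩
          r * (t * r′) ≡⟨ solve 3 (λ r t r′ → r :* (t :* r′) := r′ :* (t :* r)) refl r t r′ ⟩
          r′ * (t * r) ≡⟨ cong (r′ *_) (sym e) ⟩
          r′ * (p + ω * q) ≡⟨ solve 4 (λ ω r p q → r :* (p :+ ω :* q) := r :* p :+ ω :* (r :* q)) refl ω r′ p q ⟩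
          r′ * p + ω * (r′ * q) ∎))

      -- The three pairs are the coordinates of `a ⊗ v` and `a ⊗ B v`.
      yz : (a₂ * z - a₃ * y ≡ 0#) × (a₂ * z′ - a₃ * z ≡ 0#)
      yz = compare y∈ z∈ z∈ z′∈ a₂∈ a₃∈ (cong Vec3.y eq) (cong Vec3.z eq)
      zx : (a₃ * x - a₁ * z ≡ 0#) × (a₃ * y - a₁ * z′ ≡ 0#)
      zx = compare z∈ z′∈ x∈ y∈ a₃∈ a₁∈ (cong Vec3.z eq) (cong Vec3.x eq)
      xy : (a₁ * y - a₂ * x ≡ 0#) × (a₁ * z - a₂ * y ≡ 0#)
      xy = compare x∈ y∈ y∈ z∈ a₁∈ a₂∈ (cong Vec3.x eq) (cong Vec3.y eq)

    -- Projective points over k in normal form, with first nonzero coordinate 1.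
    Index : Set
    Index = (Fin s × Fin s) ⊎ (Fin s ⊎ ⊤)

    representative : Index → Vec3
    representative (inj₁ (i , j)) = ⟨ 1# , elem i , elem j ⟩
    representative (inj₂ (inj₁ j)) = ⟨ 0# , 1# , elem j ⟩
    representative (inj₂ (inj₂ tt)) = ⟨ 0# , 0# , 1# ⟩

    representative-∈ : ∀ i → representative i ∈³ k
    representative-∈ (inj₁ (i , j)) = 𝕜.1∈ , elem∈ i , elem∈ j
    representative-∈ (inj₂ (inj₁ j)) = 𝕜.0∈ , 𝕜.1∈ , elem∈ j
    representative-∈ (inj₂ (inj₂ tt)) = 𝕜.0∈ , 𝕜.0∈ , 𝕜.1∈

    representative-≢0 : ∀ i → representative i ≢ zero3
    representative-≢0 (inj₁ _) = 1≢0 ∘ cong Vec3.x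
    representative-≢0 (inj₂ (inj₁ _)) = 1≢0 ∘ cong Vec3.y
    representative-≢0 (inj₂ (inj₂ tt)) = 1≢0 ∘ cong Vec3.z

    representative-injective : ∀ i j {t} → t ≢ 0# → representative i ≡ t · representative j → i ≡ j
    representative-injective i j {t} t≢0 eq = go i j (cong Vec3.x eq) (cong Vec3.y eq) (cong Vec3.z eq)
      where
      open Vec3
      leading : ∀ {i j} → 1# ≡ t * 1# → elem i ≡ t * elem j → i ≡ j
      leading 1≡t eq = injective (trans eq (trans (cong (_* _) (trans (sym (*-identityʳ t)) (sym 1≡t))) (*-identityˡ _)))
      1≢t*0 : 1# ≢ t * 0#
      1≢t*0 eq = 1≢0 (trans eq (zeroʳ t))
      0≢t*1 : 0# ≢ t * 1#
      0≢t*1 eq = t≢0 (trans (sym (*-identityʳ t)) (sym eq))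

      go : ∀ i j → x (representative i) ≡ t * x (representative j) → y (representative i) ≡ t * y (representative j) →
        z (representative i) ≡ t * z (representative j) → i ≡ j
      go (inj₁ _) (inj₁ _) e₁ e₂ e₃ = cong inj₁ (cong₂ _,_ (leading e₁ e₂) (leading e₁ e₃))
      go (inj₁ _) (inj₂ (inj₁ _)) e₁ _ _ = contradiction e₁ 1≢t*0
      go (inj₁ _) (inj₂ (inj₂ _)) e₁ _ _ = contradiction e₁ 1≢t*0
      go (inj₂ (inj₁ _)) (inj₁ _) e₁ _ _ = contradiction e₁ 0≢t*1
      go (inj₂ (inj₂ _)) (inj₁ _) e₁ _ _ = contradiction e₁ 0≢t*1
      go (inj₂ (inj₁ _)) (inj₂ (inj₁ _)) _ e₂ e₃ = cong (inj₂ ∘ inj₁) (leading e₂ e₃)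
      go (inj₂ (inj₁ _)) (inj₂ (inj₂ _)) _ e₂ _ = contradiction e₂ 1≢t*0
      go (inj₂ (inj₂ _)) (inj₂ (inj₁ _)) _ e₂ _ = contradiction e₂ 0≢t*1
      go (inj₂ (inj₂ tt)) (inj₂ (inj₂ tt)) _ _ _ = refl

    ratio : ∀ {x y} → x ≢ 0# → k x → k y → ∃ λ i → y ≡ x * elem i
    ratio {x} {y} x≢0 x∈ y∈ =
      let w , xw≡1 = inverse x x≢0
          x[wy]≡y = trans (sym (*-assoc x w y)) (trans (cong (_* y) xw≡1) (*-identityˡ y))
          wy∈ = 𝕜.÷∈ x≢0 x∈ (subst k (sym x[wy]≡y) y∈)
      in index wy∈ , trans (sym x[wy]≡y) (cong (x *_) (sym (elem-index wy∈)))

    normalise : ∀ {v} → v ∈³ k → ∃₂ λ t i → v ≡ t · representative i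
    normalise {⟨ x , y , z ⟩} (x∈ , y∈ , z∈) with x ≟ 0# | y ≟ 0#
    ... | no x≢0 | _ =
      let i , y≡ = ratio x≢0 x∈ y∈ ; j , z≡ = ratio x≢0 x∈ z∈
      in x , inj₁ (i , j) , vec-≡ (sym (*-identityʳ x)) y≡ z≡
    ... | yes refl | no y≢0 =
      let j , z≡ = ratio y≢0 y∈ z∈
      in y , inj₂ (inj₁ j) , vec-≡ (sym (zeroʳ y)) (sym (*-identityʳ y)) z≡
    ... | yes refl | yes refl = z , inj₂ (inj₂ tt) , vec-≡ (sym (zeroʳ z)) (sym (zeroʳ z)) (sym (*-identityʳ z))

    point : Index ⊎ Index → Point
    point (inj₁ i) = representative i , representative-≢0 i
    point (inj₂ i) = M (representative i) , representative-≢0 i ∘ M-kernel (representative i)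

    ∼-sym : ∀ P Q → P ∼ Q → Q ∼ P
    ∼-sym (⟨ x , y , z ⟩ , _) (_ , _) (t , t≢0 , refl) with w , tw≡1 ← inverse t t≢0 =
      w , (λ { refl → 1≢0 (trans (sym tw≡1) (zeroʳ t)) }) , vec-≡ (cancel x) (cancel y) (cancel z)
      where
      cancel : ∀ x → x ≡ w * (t * x)
      cancel x = begin
        x ≡⟨ sym (*-identityˡ x) ⟩
        1# * x ≡⟨ cong (_* x) (sym tw≡1) ⟩
        t * w * x ≡⟨ solve 3 (λ t w x → t :* w :* x := w :* (t :* x)) refl t w x ⟩
        w * (t * x) ∎

    planes-disjoint : ∀ i j → ¬ (point (inj₁ i) ∼ point (inj₂ j))
    planes-disjoint i j (_ , _ , eq) =
      disjoint (representative-∈ i) (representative-∈ j) (representative-≢0 i) (representative-≢0 j) eq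

    point-injective : ∀ i j → point i ∼ point j → i ≡ j
    point-injective (inj₁ i) (inj₁ j) (_ , t≢0 , eq) = cong inj₁ (sym (representative-injective j i t≢0 eq))
    point-injective (inj₂ i) (inj₂ j) (_ , t≢0 , eq) =
      cong inj₂ (sym (representative-injective j i t≢0 (M-injective _ _ _ eq)))
    point-injective (inj₁ i) (inj₂ j) i∼j = contradiction i∼j (planes-disjoint i j)
    point-injective (inj₂ i) (inj₁ j) i∼j = contradiction (∼-sym (point (inj₂ i)) (point (inj₁ j)) i∼j) (planes-disjoint j i)

    count : ℕ
    count = (s ℕ.* s ℕ.+ (s ℕ.+ 1)) ℕ.+ (s ℕ.* s ℕ.+ (s ℕ.+ 1))

    numbering : Fin count ↔ (Index ⊎ Index)
    numbering = (plane ⊎-cong plane) ↔-∘ Finₚ.+↔⊎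
      where
      plane : Fin (s ℕ.* s ℕ.+ (s ℕ.+ 1)) ↔ Index
      plane = (Finₚ.*↔× ⊎-cong ((↔-id _ ⊎-cong Finₚ.1↔⊤) ↔-∘ Finₚ.+↔⊎)) ↔-∘ Finₚ.+↔⊎

    open Inverse numbering using (to; from; strictlyInverseˡ; strictlyInverseʳ)

    numbered : Fin count → Point
    numbered = point ∘ to

    points : List Point
    points = tabulate numbered

    point∈points : ∀ i → point i ∈ points
    point∈points i = subst (λ j → point j ∈ points) (strictlyInverseˡ i) (∈-tabulate⁺ (from i))

    points-distinct : DistinctPoints points
    points-distinct = AllPairs.tabulate⁺ λ {i} {j} i≢j i∼j → i≢j
      (trans (sym (strictlyInverseʳ i)) (trans (cong from (point-injective (to i) (to j) i∼j)) (strictlyInverseʳ j)))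

    module _ {m n} (K-enum : Enumeration K m) (F-enum : Enumeration (λ (_ : Carrier) → ⊤) n)
      (n<m³ : n ℕ.< m ℕ.* (m ℕ.* m)) (m<s³ : m ℕ.< s ℕ.* (s ℕ.* s)) where

      -- Now the line is given and the point is sought: coefficients from k give combinations
      -- `a ∙ u` in K, and |K| < s³ forces one of them to vanish nontrivially.
      orthogonal : ∀ {u} → u ∈³ K → ∃ λ i → u ∙ representative i ≡ 0#
      orthogonal {u} u∈ =
        let a , a∈ , a≢0 , au≡0 = dependent k-enum K-enum k-sub m<s³ u combination∈
            t , i , a≡ = normalise a∈
        in i , x*y≡0⇒y≡0 (·-≢0 (a≢0 ∘ trans a≡)) (begin
          t * (u ∙ representative i) ≡⟨ cong (t *_) (∙-comm u (representative i)) ⟩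
          t * (representative i ∙ u) ≡⟨ sym (·-∙ t (representative i) u) ⟩
          (t · representative i) ∙ u ≡⟨ cong (_∙ u) (sym a≡) ⟩
          a ∙ u ≡⟨ au≡0 ⟩
          0# ∎)
        where
        combination∈ : ∀ {a} → a ∈³ k → K (a ∙ u)
        combination∈ (a∈ , b∈ , c∈) = let x∈ , y∈ , z∈ = u∈ in
          𝕂.+∈ (𝕂.+∈ (𝕂.*∈ (k⊆K a∈) x∈) (𝕂.*∈ (k⊆K b∈) y∈)) (𝕂.*∈ (k⊆K c∈) z∈)

      covers : Covers1 points
      covers P@(v , _) =
        let u , u∈ , u≢0 , uv≡0 = dependent K-enum F-enum K-sub n<m³ v (λ _ → tt)
            i , ui≡0 = orthogonal u∈
            -- `Mᵗ u` is again a vector over K, so the same argument finds the point of the second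
            -- subplane.
            j , uj≡0 = orthogonal (Mᵗ-∈ u∈)
            uMj≡0 = trans (∙-M u (representative j)) (trans (∙-comm (representative j) (Mᵗ u)) uj≡0)
        in inj₂ (point (inj₁ i) , point (inj₂ j) , point∈points (inj₁ i) , point∈points (inj₂ j) ,
          onLine P (point (inj₁ i)) (point (inj₂ j)) u≢0 uv≡0 ui≡0 uMj≡0 (planes-disjoint i j))

    point-∈ : ∀ i → proj₁ (point i) ∈³ K
    point-∈ (inj₁ i) with x∈ , y∈ , z∈ ← representative-∈ i = k⊆K x∈ , k⊆K y∈ , k⊆K z∈
    point-∈ (inj₂ i) = M-∈ (representative-∈ i)

    -- The ratio of the first two coordinates is unchanged by scaling, and for a vector over K it
    -- lies in K.
    proportional-∈ : ∀ {a t θ} → a ∈³ K → ⟨ 1# , θ , 0# ⟩ ≡ t · a → K θ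
    proportional-∈ {⟨ x , y , z ⟩} {t} {θ} (x∈ , y∈ , _) eq = 𝕂.÷∈ x≢0 x∈ (subst K (begin
      y ≡⟨ sym (*-identityˡ y) ⟩
      1# * y ≡⟨ cong (_* y) (cong Vec3.x eq) ⟩
      t * x * y ≡⟨ solve 3 (λ t x y → t :* x :* y := x :* (t :* y)) refl t x y ⟩
      x * (t * y) ≡⟨ cong (x *_) (sym (cong Vec3.y eq)) ⟩
      x * θ ∎) y∈)
      where
      x≢0 : x ≢ 0#
      x≢0 refl = 1≢0 (trans (cong Vec3.x eq) (zeroʳ t))

    -- The point (1, θ, 0) is missed, since all points of the set have representatives over K.
    ¬covers₀ : ∀ {θ} → ¬ K θ → ¬ Covers0 points
    ¬covers₀ {θ} θ∉K covers₀
      with _ , A∈ , _ , _ , eq ← covers₀ (⟨ 1# , θ , 0# ⟩ , 1≢0 ∘ cong Vec3.x)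
      with i , refl ← ∈-tabulate⁻ A∈
      = θ∉K (proportional-∈ (point-∈ (to i)) eq)

-- Numerical identities for the field orders and the size.

n<n² : ∀ n → 2 ℕ.+ n ℕ.< (2 ℕ.+ n) ℕ.* (2 ℕ.+ n)
n<n² n = ℕₚ.m<m*n (2 ℕ.+ n) (2 ℕ.+ n) (ℕ.s≤s (ℕ.s≤s ℕ.z≤n))

module _ where
  open +-*-Solver

  -- s² = 2 + squareExcess e for s = 2 + e, as fixedPoints expects its exponents.
  squareExcess : ℕ → ℕ
  squareExcess e = (2 ℕ.+ e) ℕ.+ e ℕ.* (3 ℕ.+ e)

  private
    :s : ∀ {n} → Polynomial n → Polynomial n
    :s e = con 2 :+ e

    :^4 : ∀ {n} → Polynomial n → Polynomial n
    :^4 s = s :* (s :* (s :* (s :* con 1)))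

  square≡ : ∀ e → (2 ℕ.+ e) ℕ.* (2 ℕ.+ e) ≡ 2 ℕ.+ squareExcess e
  square≡ = solve 1 (λ e → :s e :* :s e := con 2 :+ (:s e :+ e :* (con 3 :+ e))) refl

  fourthPower≡square² : ∀ s → s ℕ.^ 4 ≡ (s ℕ.* s) ℕ.* (s ℕ.* s)
  fourthPower≡square² = solve 1 (λ s → :^4 s := (s :* s) :* (s :* s)) refl

  -- s⁴ - 1 = (s - 1)(s + 1)(s² + 1)
  fourthPower-factor₁ : ∀ e → let s = 2 ℕ.+ e in
    s ℕ.^ 4 ≡ suc (suc (s ℕ.* s ℕ.+ s ℕ.* (1 ℕ.+ s ℕ.* s)) ℕ.* suc e)
  fourthPower-factor₁ = solve 1 (λ e → :^4 (:s e) :=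
    con 1 :+ (con 1 :+ (:s e :* :s e :+ :s e :* (con 1 :+ :s e :* :s e))) :* (con 1 :+ e)) refl

  -- s⁴ - 1 = (s² - 1)(s² + 1)
  fourthPower-factor₂ : ∀ e → let s = 2 ℕ.+ e in
    s ℕ.^ 4 ≡ suc (suc (s ℕ.* s) ℕ.* suc (squareExcess e))
  fourthPower-factor₂ = solve 1 (λ e → :^4 (:s e) :=
    con 1 :+ (con 1 :+ :s e :* :s e) :* (con 1 :+ (:s e :+ e :* (con 3 :+ e)))) refl

  twoPlanes≡ : ∀ s → (s ℕ.* s ℕ.+ (s ℕ.+ 1)) ℕ.+ (s ℕ.* s ℕ.+ (s ℕ.+ 1)) ≡ 2 ℕ.* s ℕ.^ 2 ℕ.+ 2 ℕ.* s ℕ.+ 2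
  twoPlanes≡ = solve 1 (λ s → (s :* s :+ (s :+ con 1)) :+ (s :* s :+ (s :+ con 1)) :=
    con 2 :* (s :* (s :* con 1)) :+ con 2 :* s :+ con 2) refl

-- The cubic and its conjugate roots.

module _ (F : Field) where
  open FieldTheory F

  cubic : Carrier → Carrier
  cubic t = t * (t * t) - t

  -- The three roots of t³ - t - c sum to 0, so the third one is minus the sum of
  -- the conjugates t and t^s, which lies in the smaller field.
  conjugate-root : ∀ s → Additive (_^ s) → ∀ {c t} → c ^ s ≡ c → (t ^ s) ^ s ≡ t → t ^ s ≢ t →
    cubic t ≡ c → cubic (- (t + t ^ s)) ≡ c
  conjugate-root s add {c} {t} c∈ t∈ t∉ ft≡c = begin
    -- Replacing the linear factor 1 by S makes both sides homogeneous of degree three, and the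
    -- claim becomes a polynomial identity in t and u.
    r * (r * r) - r ≡⟨ cong (λ x → r * (r * r) - x) (trans (sym (*-identityʳ r)) (cong (r *_) (sym S≡1))) ⟩
    r * (r * r) - r * S ≡⟨ solve 2 (λ t u →
        (:- (t :+ u)) :* ((:- (t :+ u)) :* (:- (t :+ u))) :- (:- (t :+ u)) :* (t :* t :+ t :* u :+ u :* u)
        := t :* (t :* t) :- t :* (t :* t :+ t :* u :+ u :* u)) refl t u ⟩
    t * (t * t) - t * S ≡⟨ cong (λ x → t * (t * t) - x) (trans (cong (t *_) S≡1) (*-identityʳ t)) ⟩
    cubic t ≡⟨ ft≡c ⟩
    c ∎
    where
    u = t ^ s
    r = - (t + u)
    S = t * t + t * u + u * u

    t³≡ : t * (t * t) ≡ c + t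
    t³≡ = trans (solve 2 (λ x t → x := (x :- t) :+ t) refl (t * (t * t)) t) (cong (_+ t) ft≡c)

    u³≡ : u * (u * u) ≡ c + u
    u³≡ = begin
      u * (u * u) ≡⟨ cong (u *_) (sym (^-distrib-* t t s)) ⟩
      u * (t * t) ^ s ≡⟨ sym (^-distrib-* t (t * t) s) ⟩
      (t * (t * t)) ^ s ≡⟨ cong (_^ s) t³≡ ⟩
      (c + t) ^ s ≡⟨ add c t ⟩
      c ^ s + u ≡⟨ cong (_+ u) c∈ ⟩
      c + u ∎

    -- Subtract the equations for the roots t and u, then divide by t - u.
    S≡1 : S ≡ 1#
    S≡1 = *-cancelˡ (t∉ ∘ sym ∘ x-y≡0⇒x≡y) (begin
      (t - u) * S ≡⟨ solve 2 (λ t u → (t :- u) :* (t :* t :+ t :* u :+ u :* u) := t :* (t :* t) :- u :* (u :* u)) refl t u ⟩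
      t * (t * t) - u * (u * u) ≡⟨ cong₂ _-_ t³≡ u³≡ ⟩
      (c + t) - (c + u) ≡⟨ solve 3 (λ c t u → (c :+ t) :- (c :+ u) := t :- u) refl c t u ⟩
      t - u ≡⟨ sym (*-identityʳ _) ⟩
      (t - u) * 1# ∎)

  -- The subfields k and K, and the choice of ω, θ and c.

  module _ (e : ℕ) {p n} (p-prime : Prime p) (s≡pⁿ : 2 ℕ.+ e ≡ p ℕ.^ n) (F↔Fin : HasOrder F ((2 ℕ.+ e) ℕ.^ 4)) where
    open Finite F↔Fin
    open Projective F

    private
      s = 2 ℕ.+ e
      e₂ = squareExcess e

    s²≡ : s ℕ.* s ≡ 2 ℕ.+ e₂
    s²≡ = square≡ e

    k K : Pred Carrier 0ℓ
    k x = x ^ (2 ℕ.+ e) ≡ x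
    K x = x ^ (2 ℕ.+ e₂) ≡ x

    k-enum : Enumeration k (2 ℕ.+ e)
    k-enum = fixedPoints e (s ℕ.* s ℕ.+ s ℕ.* (1 ℕ.+ s ℕ.* s)) (fourthPower-factor₁ e)

    K-enum : Enumeration K (2 ℕ.+ e₂)
    K-enum = fixedPoints e₂ (s ℕ.* s) (fourthPower-factor₂ e)

    F-enum : Enumeration (λ (_ : Carrier) → ⊤) (s ℕ.^ 4)
    F-enum = record
      { elem = Inverse.from F↔Fin ; elem∈ = λ _ → tt
      ; injective = λ {i} {j} eq → trans (sym (Inverse.strictlyInverseˡ F↔Fin i)) (trans (cong (Inverse.to F↔Fin) eq) (Inverse.strictlyInverseˡ F↔Fin j))
      ; surjective = λ {x} _ → Inverse.to F↔Fin x , Inverse.strictlyInverseʳ F↔Fin x }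

    additive : Additive (_^ s)
    additive = subst (λ m → Additive (_^ m)) (sym s≡pⁿ) (frobenius-additive
      ([x+y]^p≡x^p+y^p p-prime (characteristic p (n ℕ.* 4)
        (subst (HasOrder F) (trans (cong (ℕ._^ 4) s≡pⁿ) (ℕₚ.^-*-assoc p n 4)) F↔Fin))) n)

    ^s² : ∀ x → (x ^ s) ^ s ≡ x ^ (2 ℕ.+ e₂)
    ^s² x = trans (^-assocʳ x s s) (cong (x ^_) s²≡)

    k-sub : IsSubfield k
    k-sub = fixed-isSubfield (suc e) additive

    K-sub : IsSubfield K
    K-sub = fixed-isSubfield (suc e₂) λ x y → begin
      (x + y) ^ (2 ℕ.+ e₂) ≡⟨ sym (^s² (x + y)) ⟩
      ((x + y) ^ s) ^ s ≡⟨ cong (_^ s) (additive x y) ⟩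
      (x ^ s + y ^ s) ^ s ≡⟨ additive (x ^ s) (y ^ s) ⟩
      (x ^ s) ^ s + (y ^ s) ^ s ≡⟨ cong₂ _+_ (^s² x) (^s² y) ⟩
      x ^ (2 ℕ.+ e₂) + y ^ (2 ℕ.+ e₂) ∎

    k⊆K : k ⊆ K
    k⊆K {x} x∈ = trans (sym (^s² x)) (trans (cong (_^ s) x∈) x∈)

    s⁴≡ : s ℕ.^ 4 ≡ (2 ℕ.+ e₂) ℕ.* (2 ℕ.+ e₂)
    s⁴≡ = trans (fourthPower≡square² s) (cong₂ ℕ._*_ s²≡ s²≡)

    s<s² : s ℕ.< 2 ℕ.+ e₂
    s<s² = subst (s ℕ.<_) s²≡ (n<n² e)

    s²<s⁴ : 2 ℕ.+ e₂ ℕ.< s ℕ.^ 4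
    s²<s⁴ = subst (2 ℕ.+ e₂ ℕ.<_) (sym s⁴≡) (n<n² e₂)

    s²<s³ : 2 ℕ.+ e₂ ℕ.< s ℕ.* (s ℕ.* s)
    s²<s³ = subst (ℕ._< s ℕ.* (s ℕ.* s)) s²≡ (ℕₚ.*-monoʳ-< s (n<n² e))

    s⁴<s⁶ : s ℕ.^ 4 ℕ.< (2 ℕ.+ e₂) ℕ.* ((2 ℕ.+ e₂) ℕ.* (2 ℕ.+ e₂))
    s⁴<s⁶ = subst (ℕ._< (2 ℕ.+ e₂) ℕ.* ((2 ℕ.+ e₂) ℕ.* (2 ℕ.+ e₂))) (sym s⁴≡) (ℕₚ.*-monoʳ-< (2 ℕ.+ e₂) (n<n² e₂))

    -- This collision in k is what provides a value c that the cubic misses.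
    cubic0≡cubic1 : cubic 0# ≡ cubic 1#
    cubic0≡cubic1 = begin
      0# * (0# * 0#) - 0# ≡⟨ x≡y⇒x-y≡0 (zeroˡ _) ⟩
      0# ≡⟨ sym (x≡y⇒x-y≡0 (trans (*-identityˡ _) (*-identityˡ _))) ⟩
      1# * (1# * 1#) - 1# ∎

    open IsSubfield k-sub

    -- A cubic without roots in k acquires none in a quadratic extension: two conjugate roots would
    -- leave the third one in k.
    rootless : ∀ {c} → k c → (∀ t → k t → cubic t ≢ c) → ∀ {t} → K t → cubic t ≢ c
    rootless {c} c∈ missed {t} t∈ root = decide (t ^ s ≟ t)
      where
      u = t ^ s

      u^s≡t : u ^ s ≡ t
      u^s≡t = trans (^s² t) t∈

      -- The s-th power map exchanges t and u, hence fixes their sum.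
      sum∈ : (t + u) ^ s ≡ t + u
      sum∈ = begin
        (t + u) ^ s ≡⟨ additive t u ⟩
        u + u ^ s ≡⟨ cong (u +_) u^s≡t ⟩
        u + t ≡⟨ +-comm u t ⟩
        t + u ∎

      decide : Dec (u ≡ t) → ⊥
      decide (yes t∈k) = missed t t∈k root
      decide (no t∉k) = missed (- (t + u)) (-∈ {t + u} sum∈) (conjugate-root s additive {c} {t} c∈ u^s≡t t∉k root)

    saturating-set : ∃ λ S → DistinctPoints S × length S ≡ 2 ℕ.* s ℕ.^ 2 ℕ.+ 2 ℕ.* s ℕ.+ 2 × OneSaturating S
    -- The three choices are ω in K outside k for `M`, θ outside K for minimality, and c for the
    -- cubic.
    saturating-set = construct (∃-outside K-enum k-enum (λ x → x ^ s ≟ x) s<s²)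
      (∃-outside F-enum K-enum (λ x → x ^ (2 ℕ.+ e₂) ≟ x) s²<s⁴)
      (∃-missed k-enum _≟_ cubic (λ {x} x∈ → minus∈ {x * (x * x)} {x} (*∈ {x} {x * x} x∈ (*∈ {x} {x} x∈ x∈)) x∈)
        0∈ 1∈ 0≢1 cubic0≡cubic1)
      where
      construct : (∃ λ ω → K ω × ¬ k ω) → (∃ λ θ → ⊤ × ¬ K θ) → (∃ λ c → k c × (∀ t → k t → cubic t ≢ c)) →
        ∃ λ S → DistinctPoints S × length S ≡ 2 ℕ.* s ℕ.^ 2 ℕ.+ 2 ℕ.* s ℕ.+ 2 × OneSaturating S
      construct (ω , ω∈K , ω∉k) (θ , _ , θ∉K) (c , c∈k , missed) =
        points , points-distinct , trans (length-tabulate numbered) (twoPlanes≡ s) ,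
        covers K-enum F-enum s⁴<s⁶ s²<s³ , ¬covers₀ {θ} θ∉K
        where
        open DisjointSubplanes F _≟_ {K} {k} K-sub k-sub k⊆K {s} k-enum {ω} {c} ω∈K ω∉k c∈k (rootless c∈k missed)

-- The result for an arbitrary prime power.

1<^ : ∀ {p} → Prime p → ∀ {n} → n ℕ.≥ 1 → 1 ℕ.< p ℕ.^ n
1<^ {p} p-prime = ℕₚ.^-monoʳ-< p (ℕ.nonTrivial⇒n>1 p {{prime⇒nonTrivial p-prime}})

open import Data.Nat using (_+_; _*_; _^_)

theorem3 : (q′ : ℕ) → IsPrimePower q′ → (F : Field) → HasOrder F (q′ ^ 4) →
    let open Projective F in
    ∃[ S ] (DistinctPoints S × length S ≡ 2 * q′ ^ 2 + 2 * q′ + 2 × OneSaturating S)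
theorem3 q′ (p , n , p-prime , n≥1 , q′≡pⁿ) F F↔Fin = from-2+ q′ (subst (1 ℕ.<_) (sym q′≡pⁿ) (1<^ p-prime n≥1)) q′≡pⁿ F↔Fin
  where
  open Projective F
  -- q′ is generalised to a variable so that matching can expose the form 2 + e, on which the
  -- exponents of the fixed-point equations rely.
  from-2+ : ∀ q → 1 ℕ.< q → q ≡ p ^ n → HasOrder F (q ^ 4) →
    ∃[ S ] (DistinctPoints S × length S ≡ 2 * q ^ 2 + 2 * q + 2 × OneSaturating S)
  from-2+ (suc (suc e)) _ = saturating-set F e {p} {n} p-prime
  from-2+ (suc zero) (ℕ.s≤s ())
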